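{- Let $k\in\mathbb{N}$ and let $\{G^{(r)}\}$ be an admissible group ensemble of $k$-SUM density $1$. Suppose there exists an algorithm that runs in time $T(r)$ and solves planted search $k$-SUM over $\{G^{(r)}\}$ with success probability at least $\epsilon(r)$. Then the same algorithm also solves non-planted search $k$-SUM over $\{G^{(r)}\}$ with success probability at least $\epsilon(r)^{3/2}/(21k^k)$.
   Context: All logarithms are base 2; algorithms may be randomized. A group ensemble is a sequence $\{G^{(r)}\}_{r\ge1}$ of finite abelian groups written additively. Its $k$-SUM density is $\Delta_k=\lim_{r\to\infty}\Delta_k^{(r)}$, where $\Delta_k^{(r)}=\frac{k\log r}{\log|G^{(r)}|}$. It is admissible for $k$-SUM if: uniformly random elements of $G^{(r)}$ can be sampled in time $O(\log|G^{(r)}|\,\mathrm{polylog}\log|G^{(r)}|)$; the group operation of $G^{(r)}$ can be computed in time $O(\mathrm{polylog}|G^{(r)}|)$; and $\Delta_k$ exists, is finite, and $|\Delta_k^{(r)}-\Delta_k|/\Delta_k\le 1/\log|G^{(r)}|$ for all $r$. Non-planted distribution $D_0^{(r)}$: $X=(X_1,\dots,X_r)$ with $X_i$ i.i.d. uniform in $G^{(r)}$. Planted distribution $D_1^{(r)}$: sample $X_1,\dots,X_r$ i.i.d. uniformly from $G^{(r)}$; choose a uniformly random $S\subseteq[r]$ with $|S|=k$; let $i=\min S$ and replace $X_i$ by $-\sum_{j\in S,j\ne i}X_j$; output $X$. An algorithm solves non-planted (respectively planted) search $k$-SUM with success probability $\epsilon(r)$ if, on input $X\sim D_0^{(r)}$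 (respectively $X\sim D_1^{(r)}$), it outputs with probability at least $\epsilon(r)$ (over $X$ and its coins) a set $S'\subseteq[r]$, $|S'|=k$, with $\sum_{i\in S'}X_i=0$. -}

module Defs where

open import Algebra.Bundles using (AbelianGroup)
open import Data.Bool.Base using (Bool; true; false; _∧_; if_then_else_)
open import Data.Fin.Base using (Fin; toℕ; fromℕ<)
import Data.Fin.Properties as Fin
open import Data.Fin.Subset using (Subset; inside; outside; ⁅_⁆; _∪_; ∣_∣) renaming (⊥ to ∅)
open import Data.Integer.Base using (+_)
import Data.Integer.Base as ℤ
import Data.Integer.Properties as ℤ
open import Data.List.Base using (List; []; _∷_; _++_; head; drop; length; lookup; map)
open import Data.List.Properties using (≡-dec; length-++; length-map)
open import Data.Maybe.Base using (Maybe; just; nothing)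
import Data.Maybe.Base as Maybe
open import Data.Nat.Base using (ℕ; zero; suc; NonZero; NonTrivial; z≤n; s≤s)
import Data.Nat.Base as ℕ
import Data.Nat.DivMod as ℕ
open import Data.Nat.Induction using (<-rec)
open import Data.Nat.Logarithm
import Data.Nat.Properties as ℕ
open import Data.Product.Base using (Σ; ∃; _×_; _,_; proj₁; proj₂)
open import Data.Rational.Base using (ℚ; 0ℚ; 1ℚ; ½; mkℚ)
import Data.Rational.Base as ℚ
import Data.Rational.Properties as ℚ
open import Data.Rational.Solver using (module +-*-Solver)
import Data.Rational.Unnormalised.Base as ℚᵘ
import Data.Rational.Unnormalised.Properties as ℚᵘ
open import Data.Sum.Base using (inj₁; inj₂)
open import Data.Unit.Base using (tt)
open import Data.Vec.Base using (Vec; []; _∷_; toList)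
open import Function.Base using (_∘_)
open import Function.Bundles using (Inverse; Injection)
open import Level using (Level; _⊔_) renaming (suc to lsuc)
open import Relation.Binary.PropositionalEquality
  using (_≡_; _≢_; refl; sym; trans; cong; cong₂; subst; subst₂)
import Relation.Binary.PropositionalEquality as ≡
open import Relation.Nullary using (Dec; yes; no; does; ¬_; contradiction)

open import Algebra.Properties.CommutativeMonoid.Sum ℚ.+-0-commutativeMonoid
  using () renaming (sum to sumℚ)

module Arithmetic where

  open +-*-Solver
  open Data.Rational.Base using (_≤_; _<_; _+_; _*_; _-_; -_)

  cancel : ∀ p q → (p + q) - q ≡ p
  cancel = solve 2 (λ p q → (p :+ q) :- q := p) refl

  restore : ∀ p q → (p - q) + q ≡ p
  restore = solve 2 (λ p q → (p :- q) :+ q := p) refl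

  x≤z+y⇒x-y≤z : ∀ {p q r} → p ≤ r + q → p - q ≤ r
  x≤z+y⇒x-y≤z {p} {q} {r} h = subst (p - q ≤_) (cancel r q) (ℚ.+-monoˡ-≤ (- q) h)

  x-y≤z⇒x≤z+y : ∀ {p q r} → p - q ≤ r → p ≤ r + q
  x-y≤z⇒x≤z+y {p} {q} {r} h = subst (_≤ r + q) (restore p q) (ℚ.+-monoˡ-≤ q h)

  neg-flip : ∀ p q → - (p - q) ≡ q - p
  neg-flip = solve 2 (λ p q → :- (p :- q) := q :- p) refl

  p≤∣p∣ : ∀ p → p ≤ ℚ.∣ p ∣
  p≤∣p∣ p with ℚ.≤-total 0ℚ p
  ... | inj₁ 0≤p = ℚ.≤-reflexive (sym (ℚ.0≤p⇒∣p∣≡p 0≤p))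
  ... | inj₂ p≤0 = ℚ.≤-trans p≤0 (ℚ.0≤∣p∣ p)

  ∣p-q∣≡∣q-p∣ : ∀ p q → ℚ.∣ p - q ∣ ≡ ℚ.∣ q - p ∣
  ∣p-q∣≡∣q-p∣ p q =
    trans (sym (ℚ.∣-p∣≡∣p∣ (p - q))) (cong ℚ.∣_∣ (neg-flip p q))

  close⇒≤ : ∀ {p q e} → ℚ.∣ p - q ∣ ≤ e → p ≤ e + q
  close⇒≤ {p} {q} h = x-y≤z⇒x≤z+y (ℚ.≤-trans (p≤∣p∣ (p - q)) h)

  ≤⇒close : ∀ {p q e} → p ≤ e + q → q ≤ e + p → ℚ.∣ p - q ∣ ≤ e
  ≤⇒close {p} {q} {e} h₁ h₂ with ℚ.∣p∣≡p∨∣p∣≡-p (p - q)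
  ... | inj₁ eq = subst (_≤ e) (sym eq) (x≤z+y⇒x-y≤z h₁)
  ... | inj₂ eq = subst (_≤ e) (sym (trans eq (neg-flip p q))) (x≤z+y⇒x-y≤z h₂)

  pos*pos : ∀ {p q} → 0ℚ < p → 0ℚ < q → 0ℚ < p * q
  pos*pos {p} {q} 0<p 0<q = ℚ.positive⁻¹ (p * q)
    {{ℚ.pos*pos⇒pos p {{ℚ.positive 0<p}} q {{ℚ.positive 0<q}}}}

  *-mono-≤ : ∀ {p q r s} → 0ℚ ≤ p → 0ℚ ≤ s → p ≤ q → r ≤ s → p * r ≤ q * s
  *-mono-≤ {p} {q} {r} {s} 0≤p 0≤s p≤q r≤s = ℚ.≤-trans
    (ℚ.*-monoˡ-≤-nonNeg p {{ℚ.nonNegative 0≤p}} r≤s)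
    (ℚ.*-monoʳ-≤-nonNeg s {{ℚ.nonNegative 0≤s}} p≤q)

  square-cancel-≤ : ∀ {p q} → 0ℚ ≤ p → 0ℚ ≤ q → p * p ≤ q * q → p ≤ q
  square-cancel-≤ {p} {q} 0≤p 0≤q h with p ℚ.≤? q
  ... | yes p≤q = p≤q
  ... | no p≰q = contradiction (ℚ.≤-<-trans h q²<p²) (ℚ.<-irrefl refl)
    where
    q<p : q < p
    q<p = ℚ.≰⇒> p≰q
    q²<p² : q * q < p * p
    q²<p² = ℚ.≤-<-trans
      (ℚ.*-monoˡ-≤-nonNeg q {{ℚ.nonNegative 0≤q}} (ℚ.<⇒≤ q<p))
      (ℚ.*-monoˡ-<-pos p {{ℚ.positive (ℚ.≤-<-trans 0≤q q<p)}} q<p)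

  sqrt-step : ∀ {a b c u v h e} → 0ℚ ≤ a → 0ℚ ≤ b → 0ℚ ≤ h → h + h ≡ e →
              a * a ≤ u → v ≤ b * b → u ≤ h * h + v → b ≤ h + c → a ≤ e + c
  sqrt-step {a} {b} {c} {u} {v} {h} {e} 0≤a 0≤b 0≤h h+h≡e a²≤u v≤b² u≤h²+v b≤h+c = ℚ.≤-trans
    (square-cancel-≤ 0≤a (ℚ.+-mono-≤ 0≤h 0≤b) a²≤[h+b]²)
    (ℚ.≤-trans (ℚ.+-monoʳ-≤ h b≤h+c) (ℚ.≤-reflexive
      (trans (sym (ℚ.+-assoc h h c)) (cong (_+ c) h+h≡e))))
    where
    0≤hb : 0ℚ ≤ h * b
    0≤hb = ℚ.nonNegative⁻¹ (h * b)
      {{ℚ.nonNeg*nonNeg⇒nonNeg h {{ℚ.nonNegative 0≤h}} b {{ℚ.nonNegative 0≤b}}}}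
    a²≤[h+b]² : a * a ≤ (h + b) * (h + b)
    a²≤[h+b]² = ℚ.≤-trans a²≤u (ℚ.≤-trans u≤h²+v (ℚ.≤-trans (ℚ.+-monoʳ-≤ (h * h) v≤b²)
      (subst₂ _≤_ (ℚ.+-identityʳ (h * h + b * b))
        (solve 2 (λ h b → (h :* h :+ b :* b) :+ (h :* b :+ h :* b) := (h :+ b) :* (h :+ b)) refl h b)
        (ℚ.+-monoʳ-≤ (h * h + b * b) (ℚ.+-mono-≤ 0≤hb 0≤hb)))))

  fraction-mono-≤ : ∀ {a b c d} → a ℕ.* suc d ℕ.≤ c ℕ.* suc b →
                    (+ a) ℚ./ suc b ≤ (+ c) ℚ./ suc d
  fraction-mono-≤ {a} {b} {c} {d} h = ℚ.toℚᵘ-cancel-≤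
    (ℚᵘ.≤-respˡ-≃ (ℚᵘ.≃-sym (ℚ.toℚᵘ-fromℚᵘ (ℚᵘ.mkℚᵘ (+ a) b)))
      (ℚᵘ.≤-respʳ-≃ (ℚᵘ.≃-sym (ℚ.toℚᵘ-fromℚᵘ (ℚᵘ.mkℚᵘ (+ c) d)))
        (ℚᵘ.*≤* (subst₂ ℤ._≤_ (ℤ.pos-* a (suc d)) (ℤ.pos-* c (suc b)) (ℤ.+≤+ h)))))

  fraction-+ : ∀ a b d → (+ (a ℕ.+ b)) ℚ./ suc d ≡ (+ a) ℚ./ suc d + (+ b) ℚ./ suc d
  fraction-+ a b d = ℚ.toℚᵘ-injective (begin
    ℚ.toℚᵘ ((+ (a ℕ.+ b)) ℚ./ suc d)
      ≈⟨ ℚ.toℚᵘ-fromℚᵘ (ℚᵘ.mkℚᵘ (+ (a ℕ.+ b)) d) ⟩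
    ℚᵘ.mkℚᵘ (+ (a ℕ.+ b)) d
      ≈⟨ ℚᵘ.*≡* core ⟩
    ℚᵘ.mkℚᵘ (+ a) d ℚᵘ.+ ℚᵘ.mkℚᵘ (+ b) d
      ≈⟨ ℚᵘ.+-cong (ℚ.toℚᵘ-fromℚᵘ (ℚᵘ.mkℚᵘ (+ a) d)) (ℚ.toℚᵘ-fromℚᵘ (ℚᵘ.mkℚᵘ (+ b) d)) ⟨
    ℚ.toℚᵘ ((+ a) ℚ./ suc d) ℚᵘ.+ ℚ.toℚᵘ ((+ b) ℚ./ suc d)
      ≈⟨ ℚ.toℚᵘ-homo-+ ((+ a) ℚ./ suc d) ((+ b) ℚ./ suc d) ⟨
    ℚ.toℚᵘ ((+ a) ℚ./ suc d + (+ b) ℚ./ suc d) ∎)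
    where
    open ℚᵘ.≃-Reasoning
    core : (+ (a ℕ.+ b)) ℤ.* (+ (suc d ℕ.* suc d)) ≡
           ((+ a) ℤ.* (+ suc d) ℤ.+ (+ b) ℤ.* (+ suc d)) ℤ.* (+ suc d)
    core = trans (cong₂ ℤ._*_ (ℤ.pos-+ a b) (ℤ.pos-* (suc d) (suc d)))
      (trans (sym (ℤ.*-assoc ((+ a) ℤ.+ (+ b)) (+ suc d) (+ suc d)))
             (cong (ℤ._* (+ suc d)) (ℤ.*-distribʳ-+ (+ suc d) (+ a) (+ b))))

  fraction-suc : ∀ a d {e} → (+ 1) ℚ./ suc d ≤ e → (+ suc a) ℚ./ suc d ≤ e + (+ a) ℚ./ suc d
  fraction-suc a d {e} h = subst (_≤ e + (+ a) ℚ./ suc d) (sym (fraction-+ 1 a d))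
    (ℚ.+-monoˡ-≤ ((+ a) ℚ./ suc d) h)

  fraction-nonNeg : ∀ a d → 0ℚ ≤ (+ a) ℚ./ suc d
  fraction-nonNeg a d = fraction-mono-≤ {0} {0} {a} {d} z≤n

  archimedean : ∀ e → 0ℚ < e → ∃ λ N → ∀ n → N ℕ.≤ n → (+ 1) ℚ./ suc n ≤ e
  archimedean e@(mkℚ (+ suc p) d _) _ = d , λ n d≤n →
    subst ((+ 1) ℚ./ suc n ≤_) (ℚ.↥p/↧p≡p e)
      (fraction-mono-≤ {1} {n} {suc p} {d}
        (ℕ.≤-trans (ℕ.≤-reflexive (ℕ.*-identityˡ (suc d)))
          (ℕ.≤-trans (s≤s d≤n) (ℕ.m≤n*m (suc n) (suc p)))))
  archimedean (mkℚ (+ zero) _ _) (ℚ.*<* (ℤ.+<+ ()))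
  archimedean (mkℚ (ℤ.-[1+ _ ]) _ _) (ℚ.*<* ())

  2^⌊log₂1+n⌋≤1+n : ∀ n → 2 ℕ.^ ⌊log₂ suc n ⌋ ℕ.≤ suc n
  2^⌊log₂1+n⌋≤1+n = <-rec (λ n → 2 ℕ.^ ⌊log₂ suc n ⌋ ℕ.≤ suc n) step
    where
    step : ∀ n → (∀ {m} → m ℕ.< n → 2 ℕ.^ ⌊log₂ suc m ⌋ ℕ.≤ suc m) →
           2 ℕ.^ ⌊log₂ suc n ⌋ ℕ.≤ suc n
    step zero rec = s≤s z≤n
    step (suc n) rec = begin
      2 ℕ.^ ⌊log₂ suc (suc n) ⌋             ≡⟨ cong (2 ℕ.^_) log≡ ⟩
      2 ℕ.* 2 ℕ.^ ⌊log₂ suc ⌊ n /2⌋ ⌋       ≤⟨ ℕ.*-monoʳ-≤ 2 (rec (s≤s (ℕ.⌊n/2⌋≤n n))) ⟩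
      2 ℕ.* suc ⌊ n /2⌋                     ≡⟨ cong (suc ⌊ n /2⌋ ℕ.+_) (ℕ.+-identityʳ (suc ⌊ n /2⌋)) ⟩
      suc ⌊ n /2⌋ ℕ.+ suc ⌊ n /2⌋           ≤⟨ ℕ.+-monoʳ-≤ (suc ⌊ n /2⌋) (s≤s (ℕ.⌊n/2⌋≤⌈n/2⌉ n)) ⟩
      suc ⌊ n /2⌋ ℕ.+ suc ⌈ n /2⌉           ≡⟨ ℕ.⌊n/2⌋+⌈n/2⌉≡n (suc (suc n)) ⟩
      suc (suc n)                           ∎
      where
      open ℕ.≤-Reasoning
      open Data.Nat.Base using (⌊_/2⌋; ⌈_/2⌉)
      1≤log : 1 ℕ.≤ ⌊log₂ suc (suc n) ⌋
      1≤log = ℕ.≤-trans (ℕ.≤-reflexive (sym (⌊log₂[2^n]⌋≡n 1)))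
                (⌊log₂⌋-mono-≤ {2} {suc (suc n)} (s≤s (s≤s z≤n)))
      log≡ : ⌊log₂ suc (suc n) ⌋ ≡ suc ⌊log₂ suc ⌊ n /2⌋ ⌋
      log≡ = trans (sym (ℕ.m+[n∸m]≡n 1≤log))
               (cong suc (sym (⌊log₂⌊n/2⌋⌋≡⌊log₂n⌋∸1 (suc (suc n)))))

  2^⌊log₂n⌋≤n : ∀ n → .{{NonZero n}} → 2 ℕ.^ ⌊log₂ n ⌋ ℕ.≤ n
  2^⌊log₂n⌋≤n (suc n) = 2^⌊log₂1+n⌋≤1+n n

  n<2^[1+⌊log₂n⌋] : ∀ n → n ℕ.< 2 ℕ.^ suc ⌊log₂ n ⌋
  n<2^[1+⌊log₂n⌋] n with 2 ℕ.^ suc ⌊log₂ n ⌋ ℕ.≤? n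
  ... | no ≰n = ℕ.≰⇒> ≰n
  ... | yes ≤n = contradiction
    (ℕ.≤-trans (ℕ.≤-reflexive (sym (⌊log₂[2^n]⌋≡n (suc ⌊log₂ n ⌋)))) (⌊log₂⌋-mono-≤ ≤n))
    ℕ.1+n≰n

open Arithmetic

-- Real numbers as Cauchy sequences of rationals, with _≃ℝ_ as their equality.

record ℝ : Set where
  constructor mkℝ
  field
    seq    : ℕ → ℚ
    cauchy : ∀ e → 0ℚ ℚ.< e → ∃ λ N → ∀ m n → N ℕ.≤ m → N ℕ.≤ n →
             ℚ.∣ seq m ℚ.- seq n ∣ ℚ.≤ e

open ℝ

infix  4 _≤ℝ_ _<ℝ_ _≃ℝ_
infixl 6 _-ℝ_
infixl 7 _*ℝ_ _/ℕ_

_≤ℝ_ : ℝ → ℝ → Set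
x ≤ℝ y = ∀ e → 0ℚ ℚ.< e → ∃ λ N → ∀ n → N ℕ.≤ n → seq x n ℚ.≤ e ℚ.+ seq y n

_<ℝ_ : ℝ → ℝ → Set
x <ℝ y = ∃ λ d → 0ℚ ℚ.< d × ∃ λ N → ∀ n → N ℕ.≤ n → d ℚ.+ seq x n ℚ.≤ seq y n

_≃ℝ_ : ℝ → ℝ → Set
x ≃ℝ y = x ≤ℝ y × y ≤ℝ x

fromℚ : ℚ → ℝ
fromℚ q = mkℝ (λ _ → q) λ e 0<e → 0 , λ _ _ _ _ →
  subst (ℚ._≤ e) (sym (cong ℚ.∣_∣ (ℚ.+-inverseʳ q))) (ℚ.<⇒≤ 0<e)

fromℕ : ℕ → ℝ
fromℕ n = fromℚ ((+ n) ℚ./ 1)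

0ℝ : ℝ
0ℝ = fromℚ 0ℚ

1ℝ : ℝ
1ℝ = fromℚ 1ℚ

-- A one-sided bound suffices for the Cauchy condition, because it is imposed
-- on both (m , n) and (n , m).
fromOneSided : (s : ℕ → ℚ) →
  (∀ e → 0ℚ ℚ.< e → ∃ λ N → ∀ m n → N ℕ.≤ m → N ℕ.≤ n → s m ℚ.≤ e ℚ.+ s n) → ℝ
fromOneSided s c = mkℝ s λ e 0<e → let (N , h) = c e 0<e in
  N , λ m n N≤m N≤n → ≤⇒close (h m n N≤m N≤n) (h n m N≤n N≤m)

oneSided : ∀ x e → 0ℚ ℚ.< e → ∃ λ N → ∀ m n → N ℕ.≤ m → N ℕ.≤ n →
           seq x m ℚ.≤ e ℚ.+ seq x n
oneSided x e 0<e = let (N , h) = cauchy x e 0<e in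
  N , λ m n N≤m N≤n → close⇒≤ (h m n N≤m N≤n)

0<½* : ∀ {e} → 0ℚ ℚ.< e → 0ℚ ℚ.< ½ ℚ.* e
0<½* = pos*pos (ℚ.positive⁻¹ ½)

½+½ : ∀ e → ½ ℚ.* e ℚ.+ ½ ℚ.* e ≡ e
½+½ e = trans (sym (ℚ.*-distribʳ-+ e ½ ½)) (ℚ.*-identityˡ e)

_-ℝ_ : ℝ → ℝ → ℝ
x -ℝ y = fromOneSided (λ n → seq x n ℚ.- seq y n) λ e 0<e →
  let (M , h) = oneSided x (½ ℚ.* e) (0<½* 0<e)
      (N , g) = oneSided y (½ ℚ.* e) (0<½* 0<e)
  in M ℕ.⊔ N , λ m n MN≤m MN≤n →
     let MN≥M = ℕ.m≤m⊔n M N ; MN≥N = ℕ.m≤n⊔m M N in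
     x-y≤z (seq x m) (seq y m) (seq x n) (seq y n) e
       (h m n (ℕ.≤-trans MN≥M MN≤m) (ℕ.≤-trans MN≥M MN≤n))
       (g n m (ℕ.≤-trans MN≥N MN≤n) (ℕ.≤-trans MN≥N MN≤m))
  where
  open +-*-Solver
  x-y≤z : ∀ a b c d e → a ℚ.≤ ½ ℚ.* e ℚ.+ c → d ℚ.≤ ½ ℚ.* e ℚ.+ b →
          a ℚ.- b ℚ.≤ e ℚ.+ (c ℚ.- d)
  x-y≤z a b c d e h g = subst₂ ℚ._≤_
    (solve 3 (λ a b d → (a :+ d) :- (b :+ d) := a :- b) refl a b d)
    (trans
      (solve 5 (λ b c d e f → ((f :+ c) :+ (f :+ b)) :- (b :+ d) := (f :+ f) :+ (c :- d))
             refl b c d e (½ ℚ.* e))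
      (cong (ℚ._+ (c ℚ.- d)) (½+½ e)))
    (ℚ.+-monoˡ-≤ (ℚ.- (b ℚ.+ d)) (ℚ.+-mono-≤ h g))

∣_∣ℝ : ℝ → ℝ
∣ x ∣ℝ = fromOneSided (λ n → ℚ.∣ seq x n ∣) λ e 0<e →
  let (N , h) = cauchy x e 0<e in
  N , λ m n N≤m N≤n → ℚ.≤-trans
    (subst (ℚ._≤ ℚ.∣ seq x m ℚ.- seq x n ∣ ℚ.+ ℚ.∣ seq x n ∣)
           (cong ℚ.∣_∣ (restore (seq x m) (seq x n)))
           (ℚ.∣p+q∣≤∣p∣+∣q∣ (seq x m ℚ.- seq x n) (seq x n)))
    (ℚ.+-monoˡ-≤ ℚ.∣ seq x n ∣ (h m n N≤m N≤n))

eventualBound : ∀ x → ∃ λ B → 0ℚ ℚ.< B × ∃ λ N → ∀ n → N ℕ.≤ n → ℚ.∣ seq x n ∣ ℚ.≤ B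
eventualBound x =
  let (N , h) = cauchy ∣ x ∣ℝ 1ℚ (ℚ.positive⁻¹ 1ℚ) in
  1ℚ ℚ.+ ℚ.∣ seq x N ∣ ,
  ℚ.<-≤-trans (ℚ.positive⁻¹ 1ℚ)
    (subst (ℚ._≤ 1ℚ ℚ.+ ℚ.∣ seq x N ∣) (ℚ.+-identityʳ 1ℚ)
           (ℚ.+-monoʳ-≤ 1ℚ (ℚ.0≤∣p∣ (seq x N)))) ,
  N , λ n N≤n → close⇒≤ (h n N N≤n ℕ.≤-refl)

invℚ : ℚ → ℚ
invℚ q with q ℚ.≟ 0ℚ
... | yes _   = 0ℚ
... | no  q≢0 = ℚ.1/_ q {{ℚ.≢-nonZero q≢0}}

*-invℚ : ∀ q → 0ℚ ℚ.< q → q ℚ.* invℚ q ≡ 1ℚ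
*-invℚ q 0<q with q ℚ.≟ 0ℚ
... | yes q≡0 = contradiction (sym q≡0) (ℚ.<⇒≢ 0<q)
... | no  q≢0 = ℚ.*-inverseʳ q {{ℚ.≢-nonZero q≢0}}

0<invℚ : ∀ q → 0ℚ ℚ.< q → 0ℚ ℚ.< invℚ q
0<invℚ q 0<q with q ℚ.≟ 0ℚ
... | yes q≡0 = contradiction (sym q≡0) (ℚ.<⇒≢ 0<q)
... | no  q≢0 = ℚ.positive⁻¹ (ℚ.1/_ q {{ℚ.≢-nonZero q≢0}})
                  {{ℚ.1/pos⇒pos q {{ℚ.positive 0<q}}}}

_*ℝ_ : ℝ → ℝ → ℝ
x *ℝ y = mkℝ (λ n → seq x n ℚ.* seq y n) λ e 0<e →
  let (A , 0<A , M , hA) = eventualBound x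
      (B , 0<B , N , hB) = eventualBound y
      C   = A ℚ.+ B
      0<C = ℚ.+-mono-< 0<A 0<B
      d   = e ℚ.* invℚ C
      0<d = pos*pos 0<e (0<invℚ C 0<C)
      (K , hx) = cauchy x d 0<d
      (L , hy) = cauchy y d 0<d
      P   = (M ℕ.⊔ N) ℕ.⊔ (K ℕ.⊔ L)
      M≤P = ℕ.≤-trans (ℕ.m≤m⊔n M N) (ℕ.m≤m⊔n (M ℕ.⊔ N) (K ℕ.⊔ L))
      N≤P = ℕ.≤-trans (ℕ.m≤n⊔m M N) (ℕ.m≤m⊔n (M ℕ.⊔ N) (K ℕ.⊔ L))
      K≤P = ℕ.≤-trans (ℕ.m≤m⊔n K L) (ℕ.m≤n⊔m (M ℕ.⊔ N) (K ℕ.⊔ L))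
      L≤P = ℕ.≤-trans (ℕ.m≤n⊔m K L) (ℕ.m≤n⊔m (M ℕ.⊔ N) (K ℕ.⊔ L))
  in P , λ m n P≤m P≤n → subst₂ ℚ._≤_
    (sym (cong ℚ.∣_∣ (split (seq x m) (seq y m) (seq x n) (seq y n))))
    (collect A B e 0<C)
    (ℚ.≤-trans
      (ℚ.∣p+q∣≤∣p∣+∣q∣ (seq x m ℚ.* (seq y m ℚ.- seq y n)) (seq y n ℚ.* (seq x m ℚ.- seq x n)))
      (ℚ.+-mono-≤
        (product (seq x m) (seq y m ℚ.- seq y n) (ℚ.<⇒≤ 0<d)
          (hA m (ℕ.≤-trans M≤P P≤m)) (hy m n (ℕ.≤-trans L≤P P≤m) (ℕ.≤-trans L≤P P≤n)))
        (product (seq y n) (seq x m ℚ.- seq x n) (ℚ.<⇒≤ 0<d)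
          (hB n (ℕ.≤-trans N≤P P≤n)) (hx m n (ℕ.≤-trans K≤P P≤m) (ℕ.≤-trans K≤P P≤n)))))
  where
  open +-*-Solver
  split : ∀ a b c d → a ℚ.* b ℚ.- c ℚ.* d ≡ a ℚ.* (b ℚ.- d) ℚ.+ d ℚ.* (a ℚ.- c)
  split = solve 4 (λ a b c d → a :* b :- c :* d := a :* (b :- d) :+ d :* (a :- c)) refl
  product : ∀ p q {A d} → 0ℚ ℚ.≤ d → ℚ.∣ p ∣ ℚ.≤ A → ℚ.∣ q ∣ ℚ.≤ d → ℚ.∣ p ℚ.* q ∣ ℚ.≤ A ℚ.* d
  product p q {A} {d} 0≤d h g = subst (ℚ._≤ A ℚ.* d) (sym (ℚ.∣p*q∣≡∣p∣*∣q∣ p q))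
    (*-mono-≤ (ℚ.0≤∣p∣ p) 0≤d h g)
  collect : ∀ A B e → 0ℚ ℚ.< A ℚ.+ B →
            A ℚ.* (e ℚ.* invℚ (A ℚ.+ B)) ℚ.+ B ℚ.* (e ℚ.* invℚ (A ℚ.+ B)) ≡ e
  collect A B e 0<C = trans
    (solve 4 (λ A B e i → A :* (e :* i) :+ B :* (e :* i) := e :* ((A :+ B) :* i)) refl
           A B e (invℚ (A ℚ.+ B)))
    (trans (cong (e ℚ.*_) (*-invℚ (A ℚ.+ B) 0<C)) (ℚ.*-identityʳ e))

-- The finitely many approximants of x that may vanish are inverted to 0.
inverse : (x : ℝ) → 0ℝ <ℝ x → ℝ
inverse x (d , 0<d , M , d≤x) = fromOneSided (λ n → invℚ (seq x n)) λ e 0<e →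
  let (N , h) = oneSided x (e ℚ.* (d ℚ.* d)) (pos*pos 0<e (pos*pos 0<d 0<d)) in
  M ℕ.⊔ N , λ m n MN≤m MN≤n →
    core (seq x m) (seq x n) e 0<e (d≤ m (ℕ.≤-trans (ℕ.m≤m⊔n M N) MN≤m)) (d≤ n (ℕ.≤-trans (ℕ.m≤m⊔n M N) MN≤n))
      (h n m (ℕ.≤-trans (ℕ.m≤n⊔m M N) MN≤n) (ℕ.≤-trans (ℕ.m≤n⊔m M N) MN≤m))
  where
  open +-*-Solver
  d≤ : ∀ n → M ℕ.≤ n → d ℚ.≤ seq x n
  d≤ n M≤n = subst (ℚ._≤ seq x n) (ℚ.+-identityʳ d) (d≤x n M≤n)
  core : ∀ a b e → 0ℚ ℚ.< e → d ℚ.≤ a → d ℚ.≤ b → b ℚ.≤ e ℚ.* (d ℚ.* d) ℚ.+ a →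
         invℚ a ℚ.≤ e ℚ.+ invℚ b
  core a b e 0<e d≤a d≤b h = ℚ.*-cancelˡ-≤-pos (a ℚ.* b) {{ℚ.positive (pos*pos 0<a 0<b)}}
    (subst₂ ℚ._≤_
      (sym (trans (solve 3 (λ a b i → (a :* b) :* i := b :* (a :* i)) refl a b (invℚ a))
                  (trans (cong (b ℚ.*_) (*-invℚ a 0<a)) (ℚ.*-identityʳ b))))
      (sym (trans (solve 4 (λ a b e i → (a :* b) :* (e :+ i) := e :* (a :* b) :+ a :* (b :* i)) refl
                           a b e (invℚ b))
                  (cong (e ℚ.* (a ℚ.* b) ℚ.+_)
                        (trans (cong (a ℚ.*_) (*-invℚ b 0<b)) (ℚ.*-identityʳ a)))))
      (ℚ.≤-trans h (ℚ.+-monoˡ-≤ a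
        (ℚ.*-monoˡ-≤-nonNeg e {{ℚ.nonNegative (ℚ.<⇒≤ 0<e)}}
          (*-mono-≤ (ℚ.<⇒≤ 0<d) (ℚ.<⇒≤ 0<b) d≤a d≤b)))))
    where
    0<a = ℚ.<-≤-trans 0<d d≤a
    0<b = ℚ.<-≤-trans 0<d d≤b

_/ℝ_⟨_⟩ : (x y : ℝ) → 0ℝ <ℝ y → ℝ
x /ℝ y ⟨ 0<y ⟩ = x *ℝ inverse y 0<y

_/ℕ_ : (x : ℝ) (n : ℕ) .{{_ : NonZero n}} → ℝ
x /ℕ n = x *ℝ fromℚ ((+ 1) ℚ./ n)

-- log₂ n is the limit of ⌊log₂ nᵐ⌋ / m as m → ∞.
log₂ : (n : ℕ) .{{_ : NonZero n}} → ℝ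
log₂ n = fromOneSided (λ m → (+ ⌊log₂ n ℕ.^ suc m ⌋) ℚ./ suc m) λ e 0<e →
  let (N , h) = archimedean e 0<e in
  N , λ m l N≤m N≤l → ℚ.≤-trans
    (fraction-mono-≤ {⌊log₂ n ℕ.^ suc m ⌋} {m} {1 ℕ.+ ⌊log₂ n ℕ.^ suc l ⌋} {l} (ℕ.<⇒≤ (bound m l)))
    (fraction-suc ⌊log₂ n ℕ.^ suc l ⌋ l (h l N≤l))
  where
  open ℕ.≤-Reasoning
  bound : ∀ m l → ⌊log₂ n ℕ.^ suc m ⌋ ℕ.* suc l ℕ.< suc ⌊log₂ n ℕ.^ suc l ⌋ ℕ.* suc m
  bound m l with ⌊log₂ n ℕ.^ suc m ⌋ ℕ.* suc l ℕ.<? suc ⌊log₂ n ℕ.^ suc l ⌋ ℕ.* suc m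
  ... | yes lt = lt
  ... | no  ≮  = contradiction too-big (ℕ.<-irrefl refl)
    where
    a = ⌊log₂ n ℕ.^ suc m ⌋
    b = ⌊log₂ n ℕ.^ suc l ⌋
    too-big : n ℕ.^ (suc m ℕ.* suc l) ℕ.< n ℕ.^ (suc m ℕ.* suc l)
    too-big = begin-strict
      n ℕ.^ (suc m ℕ.* suc l)       ≡⟨ cong (n ℕ.^_) (ℕ.*-comm (suc m) (suc l)) ⟩
      n ℕ.^ (suc l ℕ.* suc m)       ≡⟨ ℕ.^-*-assoc n (suc l) (suc m) ⟨
      (n ℕ.^ suc l) ℕ.^ suc m       <⟨ ℕ.^-monoˡ-< (suc m) (n<2^[1+⌊log₂n⌋] (n ℕ.^ suc l)) ⟩
      (2 ℕ.^ suc b) ℕ.^ suc m       ≡⟨ ℕ.^-*-assoc 2 (suc b) (suc m) ⟩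
      2 ℕ.^ (suc b ℕ.* suc m)       ≤⟨ ℕ.^-monoʳ-≤ 2 (ℕ.≮⇒≥ ≮) ⟩
      2 ℕ.^ (a ℕ.* suc l)           ≡⟨ ℕ.^-*-assoc 2 a (suc l) ⟨
      (2 ℕ.^ a) ℕ.^ suc l           ≤⟨ ℕ.^-monoˡ-≤ (suc l) (2^⌊log₂n⌋≤n (n ℕ.^ suc m) {{ℕ.m^n≢0 n (suc m)}}) ⟩
      (n ℕ.^ suc m) ℕ.^ suc l       ≡⟨ ℕ.^-*-assoc n (suc m) (suc l) ⟩
      n ℕ.^ (suc m ℕ.* suc l)       ∎

0<log₂ : ∀ n .{{_ : NonTrivial n}} → 0ℝ <ℝ log₂ n {{ℕ.nonTrivial⇒nonZero n}}
0<log₂ n = 1ℚ , ℚ.positive⁻¹ 1ℚ , 0 , λ m _ →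
  fraction-mono-≤ {1} {0} {⌊log₂ n ℕ.^ suc m ⌋} {m} (begin
    1 ℕ.* suc m                   ≡⟨ ℕ.*-identityˡ (suc m) ⟩
    suc m                         ≡⟨ ⌊log₂[2^n]⌋≡n (suc m) ⟨
    ⌊log₂ 2 ℕ.^ suc m ⌋           ≤⟨ ⌊log₂⌋-mono-≤ (ℕ.^-monoˡ-≤ (suc m) (ℕ.nonTrivial⇒n>1 n)) ⟩
    ⌊log₂ n ℕ.^ suc m ⌋           ≡⟨ ℕ.*-identityʳ ⌊log₂ n ℕ.^ suc m ⌋ ⟨
    ⌊log₂ n ℕ.^ suc m ⌋ ℕ.* 1     ∎)
  where open ℕ.≤-Reasoning

-- The largest j ≤ b with (j / (1 + m))² ≤ q, for q ≥ 0.
sqrtSearch : ℚ → ℕ → ℕ → ℕ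
sqrtSearch q m zero    = 0
sqrtSearch q m (suc b) =
  if does (((+ suc b) ℚ./ suc m) ℚ.* ((+ suc b) ℚ./ suc m) ℚ.≤? q) then suc b else sqrtSearch q m b

-- The search range always contains (1 + m)√q, since √q ≤ 1 + ∣numerator q∣.
sqrtNumerator : ℚ → ℕ → ℕ
sqrtNumerator q m = sqrtSearch q m (suc ℤ.∣ ℚ.↥ q ∣ ℕ.* suc m)

sqrtℚ : ℚ → ℕ → ℚ
sqrtℚ q m = (+ sqrtNumerator q m) ℚ./ suc m

if-dec : ∀ {a p} {A : Set a} {B : Set} (P : B → Set p) (A? : Dec A) {x y : B} →
         (A → P x) → (¬ A → P y) → P (if does A? then x else y)
if-dec P (yes a) h _ = h a
if-dec P (no ¬a) _ g = g ¬a

module SqrtBounds (q : ℚ) (0≤q : 0ℚ ℚ.≤ q) (m : ℕ) where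

  square : ℕ → ℚ
  square j = ((+ j) ℚ./ suc m) ℚ.* ((+ j) ℚ./ suc m)

  search-lower : ∀ b → square (sqrtSearch q m b) ℚ.≤ q
  search-lower zero = subst (ℚ._≤ q) (sym (trans (cong₂ ℚ._*_ (ℚ.0/n≡0 (suc m)) (ℚ.0/n≡0 (suc m))) (ℚ.*-zeroˡ 0ℚ))) 0≤q
  search-lower (suc b) = if-dec (λ j → square j ℚ.≤ q) (square (suc b) ℚ.≤? q)
    (λ h → h) (λ _ → search-lower b)

  search-upper : ∀ b → q ℚ.< square (suc b) → q ℚ.< square (suc (sqrtSearch q m b))
  search-upper zero h = h
  search-upper (suc b) h = if-dec (λ j → q ℚ.< square (suc j)) (square (suc b) ℚ.≤? q)
    (λ _ → h) (λ g → search-upper b (ℚ.≰⇒> g))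

  p : ℕ
  p = ℤ.∣ ℚ.↥ q ∣

  q≤p : ∀ q → 0ℚ ℚ.≤ q → q ℚ.≤ (+ ℤ.∣ ℚ.↥ q ∣) ℚ./ 1
  q≤p r@(mkℚ (+ a) d _) _ = subst (ℚ._≤ (+ a) ℚ./ 1) (ℚ.↥p/↧p≡p r)
    (fraction-mono-≤ {a} {d} {a} {0} (ℕ.*-monoʳ-≤ a (s≤s z≤n)))
  q≤p (mkℚ (ℤ.-[1+ _ ]) _ _) (ℚ.*≤* ())

  p<1+p : ∀ p → (+ p) ℚ./ 1 ℚ.< (+ suc p) ℚ./ 1
  p<1+p p = subst₂ ℚ._<_ (ℚ.+-identityˡ ((+ p) ℚ./ 1)) (sym (fraction-+ 1 p 0))
    (ℚ.+-monoˡ-< ((+ p) ℚ./ 1) (ℚ.positive⁻¹ 1ℚ))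

  range-large : q ℚ.< square (suc (suc p ℕ.* suc m))
  range-large = ℚ.≤-<-trans (q≤p q 0≤q) (ℚ.<-≤-trans (p<1+p p) (ℚ.≤-trans
    (ℚ.≤-reflexive (sym (ℚ.*-identityˡ ((+ suc p) ℚ./ 1))))
    (*-mono-≤ {1ℚ} (ℚ.nonNegative⁻¹ 1ℚ) (fraction-nonNeg (suc (suc p ℕ.* suc m)) m)
      (ℚ.≤-trans (fraction-mono-≤ {1} {0} {suc p} {0} (s≤s z≤n)) 1+p≤)
      1+p≤)))
    where
    1+p≤ : (+ suc p) ℚ./ 1 ℚ.≤ (+ suc (suc p ℕ.* suc m)) ℚ./ suc m
    1+p≤ = fraction-mono-≤ {suc p} {0} {suc (suc p ℕ.* suc m)} {m}
      (ℕ.≤-trans (ℕ.n≤1+n (suc p ℕ.* suc m))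
                 (ℕ.≤-reflexive (sym (ℕ.*-identityʳ (suc (suc p ℕ.* suc m))))))

  sqrt-lower : sqrtℚ q m ℚ.* sqrtℚ q m ℚ.≤ q
  sqrt-lower = search-lower (suc p ℕ.* suc m)

  sqrt-upper : q ℚ.< square (suc (sqrtNumerator q m))
  sqrt-upper = search-upper (suc p ℕ.* suc m) range-large

-- For x < 0 this is 0.
√_ : ℝ → ℝ
√ x = fromOneSided (λ n → sqrtℚ (0ℚ ℚ.⊔ seq x n) n) λ e 0<e →
  let h = ½ ℚ.* e
      0<h = 0<½* 0<e
      (M , x-close) = oneSided x (h ℚ.* h) (pos*pos 0<h 0<h)
      (N , 1/n≤h) = archimedean h 0<h
  in M ℕ.⊔ N , λ m n MN≤m MN≤n →
     core (seq x m) (seq x n) m n e 0<e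
       (x-close m n (ℕ.≤-trans (ℕ.m≤m⊔n M N) MN≤m) (ℕ.≤-trans (ℕ.m≤m⊔n M N) MN≤n))
       (1/n≤h n (ℕ.≤-trans (ℕ.m≤n⊔m M N) MN≤n))
  where
  core : ∀ p q m n e → 0ℚ ℚ.< e →
         p ℚ.≤ ½ ℚ.* e ℚ.* (½ ℚ.* e) ℚ.+ q → (+ 1) ℚ./ suc n ℚ.≤ ½ ℚ.* e →
         sqrtℚ (0ℚ ℚ.⊔ p) m ℚ.≤ e ℚ.+ sqrtℚ (0ℚ ℚ.⊔ q) n
  core p q m n e 0<e p≤q 1/n≤h = sqrt-step
    {sqrtℚ u m} {(+ suc (sqrtNumerator v n)) ℚ./ suc n} {sqrtℚ v n} {u} {v} {½ ℚ.* e} {e}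
    (fraction-nonNeg (sqrtNumerator u m) m)
    (fraction-nonNeg (suc (sqrtNumerator v n)) n)
    (ℚ.<⇒≤ (0<½* 0<e)) (½+½ e)
    (SqrtBounds.sqrt-lower u 0≤u m) (ℚ.<⇒≤ (SqrtBounds.sqrt-upper v 0≤v n))
    (ℚ.⊔-lub (ℚ.+-mono-≤ (ℚ.<⇒≤ (pos*pos (0<½* 0<e) (0<½* 0<e))) 0≤v)
      (ℚ.≤-trans p≤q (ℚ.+-monoʳ-≤ (½ ℚ.* e ℚ.* (½ ℚ.* e)) (ℚ.p≤q⊔p 0ℚ q))))
    (fraction-suc (sqrtNumerator v n) n 1/n≤h)
    where
    u = 0ℚ ℚ.⊔ p
    v = 0ℚ ℚ.⊔ q
    0≤u = ℚ.p≤p⊔q 0ℚ p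
    0≤v = ℚ.p≤p⊔q 0ℚ q

_^3/2 : ℝ → ℝ
x ^3/2 = √ (x *ℝ x *ℝ x)

private
  variable
    a b : Level
    A : Set a
    B : Set b

data Rand (A : Set a) : Set a where
  return  : A → Rand A
  uniform : (n : ℕ) .{{_ : NonZero n}} → (Fin n → Rand A) → Rand A

_>>=_ : Rand A → (A → Rand B) → Rand B
return x    >>= f = f x
uniform n g >>= f = uniform n λ i → g i >>= f

Pr : Rand A → (A → Bool) → ℚ
Pr (return x)    E = if E x then 1ℚ else 0ℚ
Pr (uniform n f) E = sumℚ (λ i → Pr (f i) E) ℚ.* ((+ 1) ℚ./ n)

Always : (A → Set) → Rand A → Set
Always P (return x)    = P x
Always P (uniform n f) = ∀ i → Always P (f i)

iid : Rand A → (r : ℕ) → Rand (Vec A r)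
iid D zero    = return []
iid D (suc r) = do
  x ← D
  X ← iid D r
  return (x ∷ X)

choose : (xs : List A) .{{_ : NonZero (length xs)}} → Rand A
choose xs = uniform (length xs) λ i → return (lookup xs i)

-- Algorithms are random access machines with a source of randomness and the
-- logarithmic cost criterion: an operation is charged the bit lengths of the
-- numbers and addresses it handles.

data Op : Set where
  add sub mul div : Op

-- Subtraction is truncated at 0, and division by 0 yields 0.
⟦_⟧ : Op → ℕ → ℕ → ℕ
⟦ add ⟧ m n       = m ℕ.+ n
⟦ sub ⟧ m n       = m ℕ.∸ n
⟦ mul ⟧ m n       = m ℕ.* n
⟦ div ⟧ m zero    = 0
⟦ div ⟧ m (suc n) = m ℕ./ suc n

-- Arguments are addresses, except the constant n of set and the line l of jzero.
-- The instruction rand i j stores a uniform element of {0, …, M j} at i, and a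
-- read beyond the end of the input yields 0.
data Instr : Set where
  set        : (i n : ℕ) → Instr
  apply      : Op → (i j l : ℕ) → Instr
  load store : (i j : ℕ) → Instr
  jzero      : (i l : ℕ) → Instr
  read write : (i : ℕ) → Instr
  rand       : (i j : ℕ) → Instr

Program : Set
Program = List Instr

record Config : Set where
  constructor config
  field
    pc     : ℕ
    mem    : ℕ → ℕ
    input  : List ℕ
    output : List ℕ
    time   : ℕ

bits : ℕ → ℕ
bits n = suc ⌊log₂ n ⌋

_[_≔_] : (ℕ → ℕ) → ℕ → ℕ → ℕ → ℕ
(M [ i ≔ n ]) j = if does (i ℕ.≟ j) then n else M j

execute : Instr → Config → Rand Config
execute (set i n) (config pc M is os t) =
  return (config (suc pc) (M [ i ≔ n ]) is os (t ℕ.+ bits i ℕ.+ bits n))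
execute (apply op i j l) (config pc M is os t) =
  return (config (suc pc) (M [ i ≔ ⟦ op ⟧ (M j) (M l) ]) is os
    (t ℕ.+ bits i ℕ.+ bits j ℕ.+ bits l ℕ.+ bits (M j) ℕ.+ bits (M l)))
execute (load i j) (config pc M is os t) =
  return (config (suc pc) (M [ i ≔ M (M j) ]) is os
    (t ℕ.+ bits i ℕ.+ bits j ℕ.+ bits (M j) ℕ.+ bits (M (M j))))
execute (store i j) (config pc M is os t) =
  return (config (suc pc) (M [ M i ≔ M j ]) is os
    (t ℕ.+ bits i ℕ.+ bits j ℕ.+ bits (M i) ℕ.+ bits (M j)))
execute (jzero i l) (config pc M is os t) =
  return (config (if does (M i ℕ.≟ 0) then l else suc pc) M is os (t ℕ.+ bits i ℕ.+ bits (M i)))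
execute (read i) (config pc M [] os t) =
  return (config (suc pc) (M [ i ≔ 0 ]) [] os (t ℕ.+ bits i ℕ.+ bits 0))
execute (read i) (config pc M (n ∷ is) os t) =
  return (config (suc pc) (M [ i ≔ n ]) is os (t ℕ.+ bits i ℕ.+ bits n))
execute (write i) (config pc M is os t) =
  return (config (suc pc) M is (os ++ M i ∷ []) (t ℕ.+ bits i ℕ.+ bits (M i)))
execute (rand i j) (config pc M is os t) =
  uniform (suc (M j)) λ n → return (config (suc pc) (M [ i ≔ toℕ n ]) is os
    (t ℕ.+ bits i ℕ.+ bits j ℕ.+ bits (M j)))

fetch : Program → ℕ → Maybe Instr
fetch P pc = head (drop pc P)

Halted : Program → Config → Set
Halted P c = fetch P (Config.pc c) ≡ nothing

step : Program → Config → Rand Config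
step P c = Maybe.maybe′ (λ ι → execute ι c) (return c) (fetch P (Config.pc c))

steps : Program → ℕ → Config → Rand Config
steps P zero    c = return c
steps P (suc n) c = step P c >>= steps P n

start : List ℕ → Config
start w = config 0 (λ _ → 0) w [] 0

-- Each step costs at least 1, so t steps are enough for a run of cost at most t.
HaltsWithin : Program → List ℕ → ℕ → Set
HaltsWithin P w t = Always (λ c → Halted P c × Config.time c ℕ.≤ t) (steps P t (start w))

-- The output distribution of P on w, provided HaltsWithin P w t.
run : Program → ℕ → List ℕ → Rand (List ℕ)
run P t w = do
  c ← steps P t (start w)
  return (Config.output c)

record FiniteAbelianGroup c ℓ : Set (lsuc (c ⊔ ℓ)) where
  field
    abelianGroup : AbelianGroup c ℓ
  open AbelianGroup abelianGroup public
    renaming (_∙_ to _+_; ε to 0#; _⁻¹ to -_)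
    using (Carrier; _≈_; setoid)
  field
    order       : ℕ
    enumeration : Inverse setoid (≡.setoid (Fin order))

  open Inverse enumeration public using () renaming (to to index; from to element)

  infix 4 _≈?_
  _≈?_ : Carrier → Carrier → Bool
  x ≈? y = does (index x Fin.≟ index y)

  order≢0 : NonZero order
  order≢0 = Fin.nonZeroIndex (index 0#)

  uniformElement : Rand Carrier
  uniformElement = uniform order {{order≢0}} λ i → return (element i)

-- Group elements are presented to algorithms as lists of numbers, through a
-- fixed injective encoding.
record GroupEnsemble c ℓ : Set (lsuc (c ⊔ ℓ)) where
  field
    group    : (r : ℕ) .{{_ : NonZero r}} → FiniteAbelianGroup c ℓ
    encoding : (r : ℕ) .{{_ : NonZero r}} →
               Injection (FiniteAbelianGroup.setoid (group r)) (≡.setoid (List ℕ))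

  module _ (r : ℕ) .{{_ : NonZero r}} where

    open FiniteAbelianGroup (group r) public using (Carrier; order; order≢0)

    encode : Carrier → List ℕ
    encode = Injection.to (encoding r)

    log∣G∣ : ℝ
    log∣G∣ = log₂ order {{order≢0}}

    0<log∣G∣ : .(NonTrivial order) → 0ℝ <ℝ log∣G∣
    0<log∣G∣ 1<∣G∣ = 0<log₂ order {{1<∣G∣}}

    -- r followed by the encodings of the elements, each preceded by its length
    encodeInput : List Carrier → List ℕ
    encodeInput xs = r ∷ Data.List.Base.concatMap (λ x → length (encode x) ∷ encode x) xs

module _ {c ℓ} (k : ℕ) (E : GroupEnsemble c ℓ) where

  open GroupEnsemble E

  density : (r : ℕ) .{{_ : NonZero r}} → .(NonTrivial (order r)) → ℝ
  density r 1<∣G∣ = (fromℕ k *ℝ log₂ r) /ℝ log∣G∣ r ⟨ 0<log∣G∣ r 1<∣G∣ ⟩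

  record Admissible : Set (c ⊔ ℓ) where
    field
      -- For |G| = 1 the density, a quotient by log |G|, is undefined.
      nontrivial : ∀ r .{{_ : NonZero r}} → NonTrivial (order r)

      -- Densities are nonnegative, so dividing by their limit means 0 < Δ.
      Δ   : ℝ
      0<Δ : 0ℝ <ℝ Δ
      density→Δ : ∀ e → 0ℝ <ℝ e → ∃ λ N → ∀ r .{{_ : NonZero r}} → N ℕ.≤ r →
                  ∣ density r (nontrivial r) -ℝ Δ ∣ℝ ≤ℝ e
      rate : ∀ r .{{_ : NonZero r}} →
             ∣ density r (nontrivial r) -ℝ Δ ∣ℝ /ℝ Δ ⟨ 0<Δ ⟩ ≤ℝ
             1ℝ /ℝ log∣G∣ r ⟨ 0<log∣G∣ r (nontrivial r) ⟩

      -- Time O(L · polylog L) and O(polylog |G|), where L = ⌈log₂ |G|⌉ ≥ 1.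
      sampler     : Program
      samplerTime : ℕ → ℕ
      sampler-runs : ∀ r .{{_ : NonZero r}} → HaltsWithin sampler (encodeInput r []) (samplerTime r)
      sampler-uniform : ∀ r .{{_ : NonZero r}} (x : Carrier r) →
        Pr (run sampler (samplerTime r) (encodeInput r []))
           (λ w → does (≡-dec ℕ._≟_ w (encode r x))) ≡
        ℚ._/_ (+ 1) (order r) {{order≢0 r}}
      sampler-fast : ∃ λ C → ∃ λ d → ∀ r .{{_ : NonZero r}} →
        samplerTime r ℕ.≤ C ℕ.* ⌈log₂ order r ⌉ ℕ.* suc ⌈log₂ ⌈log₂ order r ⌉ ⌉ ℕ.^ d

      adder     : Program
      adderTime : ℕ → ℕ
      adder-runs : ∀ r .{{_ : NonZero r}} (x y : Carrier r) →
        HaltsWithin adder (encodeInput r (x ∷ y ∷ [])) (adderTime r)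
      adder-correct : ∀ r .{{_ : NonZero r}} (x y : Carrier r) →
        Always (_≡ encode r (FiniteAbelianGroup._+_ (group r) x y))
               (run adder (adderTime r) (encodeInput r (x ∷ y ∷ [])))
      adder-fast : ∃ λ C → ∃ λ d → ∀ r .{{_ : NonZero r}} →
        adderTime r ℕ.≤ C ℕ.* ⌈log₂ order r ⌉ ℕ.^ d

-- All S ⊆ [r] with |S| = k, each listed once.
kSubsets : (r k : ℕ) → List (Subset r)
kSubsets zero    zero    = [] ∷ []
kSubsets zero    (suc k) = []
kSubsets (suc r) zero    = ∅ ∷ []
kSubsets (suc r) (suc k) = map (inside ∷_) (kSubsets r k) ++ map (outside ∷_) (kSubsets r (suc k))

kSubsets-nonEmpty : ∀ {r k} → k ℕ.≤ r → NonZero (length (kSubsets r k))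
kSubsets-nonEmpty {zero}  z≤n = _
kSubsets-nonEmpty {suc r} z≤n = _
kSubsets-nonEmpty {suc r} {suc k} (s≤s k≤r) = subst NonZero
  (sym (trans (length-++ (map (inside ∷_) (kSubsets r k)))
              (cong (ℕ._+ length (map (outside ∷_) (kSubsets r (suc k))))
                    (length-map (inside ∷_) (kSubsets r k)))))
  (ℕ.>-nonZero (ℕ.≤-trans (ℕ.>-nonZero⁻¹ (length (kSubsets r k)) {{kSubsets-nonEmpty k≤r}})
                          (ℕ.m≤m+n _ _)))

module _ {c ℓ} (G : FiniteAbelianGroup c ℓ) where

  open FiniteAbelianGroup G

  subsetSum : ∀ {r} → Subset r → Vec Carrier r → Carrier
  subsetSum []            []      = 0#
  subsetSum (inside  ∷ S) (x ∷ X) = x + subsetSum S X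
  subsetSum (outside ∷ S) (x ∷ X) = subsetSum S X

  -- At i = min S, replaces X i by minus the sum of the other X j with j ∈ S.
  plant : ∀ {r} → Subset r → Vec Carrier r → Vec Carrier r
  plant []            []      = []
  plant (inside  ∷ S) (x ∷ X) = - subsetSum S X ∷ X
  plant (outside ∷ S) (x ∷ X) = x ∷ plant S X

  D₀ : (r : ℕ) → Rand (Vec Carrier r)
  D₀ r = iid uniformElement r

  D₁ : (k r : ℕ) → k ℕ.≤ r → Rand (Vec Carrier r)
  D₁ k r k≤r = do
    X ← iid uniformElement r
    S ← choose (kSubsets r k) {{kSubsets-nonEmpty k≤r}}
    return (plant S X)

  -- The output of an algorithm is the list of the elements of S′, in any order,
  -- with [r] represented as {0, …, r - 1}.
  decode : (r : ℕ) → List ℕ → Maybe (Subset r)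
  decode r []       = just ∅
  decode r (i ∷ is) with i ℕ.<? r
  ... | yes i<r = Maybe.map (⁅ fromℕ< i<r ⁆ ∪_) (decode r is)
  ... | no  _   = nothing

  isSolution : (k : ℕ) → ∀ {r} → Vec Carrier r → List ℕ → Bool
  isSolution k {r} X w =
    Maybe.maybe′ (λ S → does (∣ S ∣ ℕ.≟ k) ∧ (subsetSum S X ≈? 0#)) false (decode r w)

module _ {c ℓ} (E : GroupEnsemble c ℓ) (P : Program) (T : ℕ → ℕ) where

  open GroupEnsemble E

  RunsInTime : Set c
  RunsInTime = ∀ r .{{_ : NonZero r}} (X : Vec (Carrier r) r) →
               HaltsWithin P (encodeInput r (toList X)) (T r)

module _ {c ℓ} (k : ℕ) (E : GroupEnsemble c ℓ) (P : Program) (T : ℕ → ℕ) where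

  open GroupEnsemble E

  successProbability : ∀ r .{{_ : NonZero r}} → Rand (Vec (Carrier r) r) → ℚ
  successProbability r D =
    Pr (do X ← D
           w ← run P (T r) (encodeInput r (toList X))
           return (isSolution (group r) k X w))
       (λ success → success)

  -- A k-subset of [r], hence the planted distribution, exists only for k ≤ r;
  -- both success conditions are imposed for these r.

  SolvesNonPlanted : (ℕ → ℝ) → Set
  SolvesNonPlanted ε = ∀ r .{{_ : NonZero r}} → k ℕ.≤ r →
    ε r ≤ℝ fromℚ (successProbability r (D₀ (group r) r))

  SolvesPlanted : (ℕ → ℝ) → Set
  SolvesPlanted ε = ∀ r .{{_ : NonZero r}} (k≤r : k ℕ.≤ r) →
    ε r ≤ℝ fromℚ (successProbability r (D₁ (group r) k r k≤r))

21k^k≢0 : ∀ k → NonZero (21 ℕ.* k ℕ.^ k)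
21k^k≢0 zero      = _
21k^k≢0 k@(suc _) = ℕ.m*n≢0 21 (k ℕ.^ k) {{_}} {{ℕ.m^n≢0 k k}}

{-# OPTIONS --safe #-}

module Submission where

-- The density of the planted distribution with respect to the non-planted one is
-- L(X) = |G| c(X) / N, where c(X) counts the solutions of X and N = C(r, k).  So a success
-- probability s(X) has planted mean 𝔼[L s] and non-planted mean 𝔼[s], and Hölder's inequality
-- gives 𝔼[L s]³ ≤ 𝔼[L³] 𝔼[s]².  It remains to bound 𝔼[L³] by a multiple of k²ᵏ.  Conditioned
-- on S and T summing to 0, the sum over V is still uniform unless V ⊆ S ∪ T, which holds for
-- at most 4ᵏ of the N sets V, or for one only if S = T.  This yields
-- 𝔼[L³] ≤ 1 + 4ᵏ ρ + (1 + ρ) ρ with ρ = |G| / N, and density 1 gives |G| ≤ 4 rᵏ ≤ 4 kᵏ N.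

open import Defs
open Arithmetic
open import Algebra.Bundles using (AbelianGroup; CommutativeRing)
import Algebra.Properties.Group as GroupProperties
import Algebra.Properties.Semiring.Sum as SemiringSum
open import Data.Bool.Base using (Bool; true; false; _∧_; if_then_else_)
open import Data.Fin.Base using (Fin; zero; suc)
import Data.Fin.Properties as Fin
open import Data.Fin.Subset
  using (Subset; Nonempty; inside; outside; _∈_; _∉_; _⊆_; _⊈_; _∪_; ∣_∣) renaming (⊥ to ∅)
open import Data.Fin.Subset.Properties
  using (_∈?_; _⊆?_; ⊥⊆; ∣⊥∣≡0; ⊆-antisym; x∈p∪q⁺; x∈p∪q⁻; q⊆p∪q)
open import Data.Integer.Base using (+_)
open import Data.List.Base using (List; []; _∷_; _++_; concatMap; length; lookup; map)
open import Data.List.Membership.Propositional.Properties using (∈-lookup)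
open import Data.List.Properties using (length-++; length-map)
open import Data.List.Relation.Unary.All as All using (All; []; _∷_)
import Data.List.Relation.Unary.All.Properties as All
open import Data.Maybe.Base using (just; nothing)
open import Data.Nat.Base as ℕ using (ℕ; zero; suc; NonZero)
open import Data.Nat.Logarithm using (⌊log₂_⌋)
import Data.Nat.Properties as ℕ
import Data.Nat.Solver as ℕ
open import Data.Product.Base using (∃; _×_; _,_; proj₁; proj₂)
open import Data.Rational.Base as ℚ using (ℚ; 0ℚ; 1ℚ)
import Data.Rational.Properties as ℚ
open import Data.Rational.Solver using (module +-*-Solver)
open import Data.Sum.Base using (inj₁; inj₂; [_,_]′)
open import Data.Vec.Base using (Vec; []; _∷_; here; there; toList; _[_]≔_)
open import Data.Vec.Relation.Binary.Pointwise.Inductive using (Pointwise; []; _∷_)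
open import Function.Base using (id; _∘_)
open import Function.Bundles using (Injection; Inverse; mk⇔)
open import Level using (Level)
open import Relation.Binary.PropositionalEquality
  using (_≡_; refl; sym; trans; cong; cong₂; subst; subst₂; module ≡-Reasoning)
open import Relation.Nullary using (does; yes; no; contradiction; ¬?; _×-dec_)
open import Relation.Nullary.Decidable using (decidable-stable; dec-true; does-⇔; toWitness)

-- The m-th moment of L gives 𝔼[L s]^m ≤ 𝔼[L^m] 𝔼[s]^(m-1), hence the exponent m/(m-1) for ε. The
-- second moment would only yield ε²; the 3/2 of the theorem is m = 3, and a bound of order k^(2k)
-- on 𝔼[L³] becomes k^k under the square root. The bound obtained is 37 k^(2k), whose root is below
-- 7 k^k. The rest of the 21 pays for the reals: inequalities hold between approximants up to an
-- arbitrarily small error, and since 8 · 37 ≤ 21² the bound on ε may be doubled before it is cubed.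
-- This absorbs the error without any continuity estimate for cubes or roots. Likewise Hölder's
-- inequality is stated with a positive upper bound for 𝔼[s] in place of 𝔼[s] itself. At density
-- exactly 1 the rate says log |G| ≤ k log r + 1, so |G| ≤ 2 rᵏ; passing to approximants turns the 2
-- into 4.

module _ where

  open import Data.Rational.Base using (_+_; _*_; _-_; -_; _≤_; _<_; _/_)
  open SemiringSum (CommutativeRing.semiring ℚ.+-*-commutativeRing)
    using (sum; sum-cong-≗; sum-replicate-zero; ∑-distrib-+; *-distribˡ-sum)

  private
    variable
      a b : Level
      A : Set a
      B : Set b

  -- Rational arithmetic and finite sums

  opaque
    -- Opaque, so that numerals stay symbolic in ring identities instead of being normalised as
    -- fractions; `ι≡/1` opens them where their values matter.
    ι : ℕ → ℚ
    ι n = (+ n) / 1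

    ι≡/1 : ∀ n → ι n ≡ (+ n) / 1
    ι≡/1 n = refl

    ι-+ : ∀ m n → ι (m ℕ.+ n) ≡ ι m + ι n
    ι-+ m n = fraction-+ m n 0

    ι-mono : ∀ {m n} → m ℕ.≤ n → ι m ≤ ι n
    ι-mono {m} {n} m≤n = fraction-mono-≤ {m} {0} {n} {0} (ℕ.*-monoˡ-≤ 1 m≤n)

    ι0≡0 : ι 0 ≡ 0ℚ
    ι0≡0 = refl

    ι1≡1 : ι 1 ≡ 1ℚ
    ι1≡1 = refl

  ι-suc : ∀ n → ι (suc n) ≡ 1ℚ + ι n
  ι-suc n = trans (ι-+ 1 n) (cong (λ p → p + ι n) ι1≡1)

  ι0* : ∀ p → ι 0 * p ≡ 0ℚ
  ι0* p = trans (cong (λ q → q * p) ι0≡0) (ℚ.*-zeroˡ p)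

  ι-suc* : ∀ n p → ι (suc n) * p ≡ p + ι n * p
  ι-suc* n p = begin
    ι (suc n) * p     ≡⟨ cong (_* p) (ι-suc n) ⟩
    (1ℚ + ι n) * p    ≡⟨ ℚ.*-distribʳ-+ p 1ℚ (ι n) ⟩
    1ℚ * p + ι n * p  ≡⟨ cong (λ q → q + ι n * p) (ℚ.*-identityˡ p) ⟩
    p + ι n * p       ∎
    where open ≡-Reasoning

  ι-* : ∀ m n → ι (m ℕ.* n) ≡ ι m * ι n
  ι-* zero    n = trans ι0≡0 (sym (ι0* (ι n)))
  ι-* (suc m) n = begin
    ι (n ℕ.+ m ℕ.* n)     ≡⟨ ι-+ n (m ℕ.* n) ⟩
    ι n + ι (m ℕ.* n)     ≡⟨ cong (λ p → ι n + p) (ι-* m n) ⟩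
    ι n + ι m * ι n       ≡⟨ ι-suc* m (ι n) ⟨
    ι (suc m) * ι n       ∎
    where open ≡-Reasoning

  0≤ι : ∀ n → 0ℚ ≤ ι n
  0≤ι n = subst (_≤ ι n) ι0≡0 (ι-mono {0} {n} ℕ.z≤n)

  /≡ι*1/ : ∀ m n .{{_ : NonZero n}} → (+ m) / n ≡ ι m * ((+ 1) / n)
  /≡ι*1/ zero    (suc n) = trans (ℚ.0/n≡0 (suc n)) (sym (ι0* ((+ 1) / suc n)))
  /≡ι*1/ (suc m) (suc n) = begin
    (+ suc m) / suc n                          ≡⟨ fraction-+ 1 m n ⟩
    (+ 1) / suc n + (+ m) / suc n
      ≡⟨ cong (λ p → (+ 1) / suc n + p) (/≡ι*1/ m (suc n)) ⟩
    (+ 1) / suc n + ι m * ((+ 1) / suc n)      ≡⟨ ι-suc* m ((+ 1) / suc n) ⟨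
    ι (suc m) * ((+ 1) / suc n)                ∎
    where open ≡-Reasoning

  n/n≡1 : ∀ n .{{_ : NonZero n}} → (+ n) / n ≡ 1ℚ
  n/n≡1 (suc n) = ℚ.≤-antisym
    (fraction-mono-≤ {suc n} {n} {1} {0} (ℕ.≤-reflexive (ℕ.*-comm (suc n) 1)))
    (fraction-mono-≤ {1} {0} {suc n} {n} (ℕ.≤-reflexive (ℕ.*-comm 1 (suc n))))

  ι*1/ : ∀ n .{{_ : NonZero n}} → ι n * ((+ 1) / n) ≡ 1ℚ
  ι*1/ n = trans (sym (/≡ι*1/ n n)) (n/n≡1 n)

  0≤1/ : ∀ n .{{_ : NonZero n}} → 0ℚ ≤ (+ 1) / n
  0≤1/ (suc n) = fraction-nonNeg 1 n

  0≤* : ∀ {p q} → 0ℚ ≤ p → 0ℚ ≤ q → 0ℚ ≤ p * q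
  0≤* {p} {q} 0≤p 0≤q =
    subst (_≤ p * q) (ℚ.*-zeroˡ q) (*-mono-≤ {0ℚ} {p} {q} {q} ℚ.≤-refl 0≤q 0≤p ℚ.≤-refl)

  0≤+ : ∀ {p q} → 0ℚ ≤ p → 0ℚ ≤ q → 0ℚ ≤ p + q
  0≤+ {p} {q} = ℚ.+-mono-≤ {0ℚ} {p} {0ℚ} {q}

  0≤1 : 0ℚ ≤ 1ℚ
  0≤1 = ℚ.nonNegative⁻¹ 1ℚ

  *-monoˡ : ∀ {p q} r → 0ℚ ≤ r → p ≤ q → r * p ≤ r * q
  *-monoˡ r 0≤r p≤q = ℚ.*-monoˡ-≤-nonNeg r {{ℚ.nonNegative 0≤r}} p≤q

  *-monoʳ : ∀ {p q} r → 0ℚ ≤ r → p ≤ q → p * r ≤ q * r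
  *-monoʳ r 0≤r p≤q = ℚ.*-monoʳ-≤-nonNeg r {{ℚ.nonNegative 0≤r}} p≤q

  sum-mono : ∀ {n} {f g : Fin n → ℚ} → (∀ i → f i ≤ g i) → sum f ≤ sum g
  sum-mono {zero}  f≤g = ℚ.≤-refl
  sum-mono {suc n} f≤g = ℚ.+-mono-≤ (f≤g zero) (sum-mono (f≤g ∘ suc))

  sum-const : ∀ n c → sum {n} (λ _ → c) ≡ ι n * c
  sum-const zero    c = sym (ι0* c)
  sum-const (suc n) c = trans (cong (λ p → c + p) (sum-const n c)) (sym (ι-suc* n c))

  𝟙 : Bool → ℚ
  𝟙 b = if b then 1ℚ else 0ℚ

  0≤𝟙 : ∀ b → 0ℚ ≤ 𝟙 b
  0≤𝟙 true  = 0≤1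
  0≤𝟙 false = ℚ.≤-refl

  𝟙≤1 : ∀ b → 𝟙 b ≤ 1ℚ
  𝟙≤1 true  = ℚ.≤-refl
  𝟙≤1 false = 0≤1

  sum-select : ∀ {n} (j : Fin n) (f : Fin n → ℚ) → sum (λ i → 𝟙 (does (i Fin.≟ j)) * f i) ≡ f j
  sum-select {suc n} zero f = begin
    1ℚ * f zero + sum (λ i → 0ℚ * f (suc i))
      ≡⟨ cong (λ s → 1ℚ * f zero + s) (sum-cong-≗ (ℚ.*-zeroˡ ∘ f ∘ suc)) ⟩
    1ℚ * f zero + sum {n} (λ _ → 0ℚ)
      ≡⟨ cong₂ _+_ (ℚ.*-identityˡ (f zero)) (sum-replicate-zero n) ⟩
    f zero + 0ℚ                               ≡⟨ ℚ.+-identityʳ (f zero) ⟩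
    f zero                                    ∎
    where open ≡-Reasoning
  sum-select (suc j) f = begin
    0ℚ * f zero + sum (λ i → 𝟙 (does (i Fin.≟ j)) * f (suc i))
      ≡⟨ cong₂ _+_ (ℚ.*-zeroˡ (f zero)) (sum-select j (f ∘ suc)) ⟩
    0ℚ + f (suc j)                                              ≡⟨ ℚ.+-identityˡ (f (suc j)) ⟩
    f (suc j)                                                   ∎
    where open ≡-Reasoning

  -- Expectations

  𝔼 : Rand A → (A → ℚ) → ℚ
  𝔼 (return x)    f = f x
  𝔼 (uniform n g) f = sum (λ i → 𝔼 (g i) f) * ((+ 1) / n)

  Pr≡𝔼 : (D : Rand A) (E : A → Bool) → Pr D E ≡ 𝔼 D (𝟙 ∘ E)
  Pr≡𝔼 (return x)    E = refl
  Pr≡𝔼 (uniform n g) E = cong (_* ((+ 1) / n)) (sum-cong-≗ (λ i → Pr≡𝔼 (g i) E))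

  𝔼->>= : (D : Rand A) (h : A → Rand B) (f : B → ℚ) → 𝔼 (D >>= h) f ≡ 𝔼 D (λ x → 𝔼 (h x) f)
  𝔼->>= (return x)    h f = refl
  𝔼->>= (uniform n g) h f = cong (_* ((+ 1) / n)) (sum-cong-≗ (λ i → 𝔼->>= (g i) h f))

  𝔼-cong : (D : Rand A) {f g : A → ℚ} → (∀ x → f x ≡ g x) → 𝔼 D f ≡ 𝔼 D g
  𝔼-cong (return x)    h = h x
  𝔼-cong (uniform n d) h = cong (_* ((+ 1) / n)) (sum-cong-≗ (λ i → 𝔼-cong (d i) h))

  𝔼-mono-Always : {P : A → Set} (D : Rand A) {f g : A → ℚ} → Always P D →
                  (∀ x → P x → f x ≤ g x) → 𝔼 D f ≤ 𝔼 D g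
  𝔼-mono-Always (return x)    p h = h x p
  𝔼-mono-Always (uniform n d) p h =
    *-monoʳ ((+ 1) / n) (0≤1/ n) (sum-mono (λ i → 𝔼-mono-Always (d i) (p i) h))

  𝔼-mono : (D : Rand A) {f g : A → ℚ} → (∀ x → f x ≤ g x) → 𝔼 D f ≤ 𝔼 D g
  𝔼-mono (return x)    h = h x
  𝔼-mono (uniform n d) h = *-monoʳ ((+ 1) / n) (0≤1/ n) (sum-mono (λ i → 𝔼-mono (d i) h))

  𝔼-const : (D : Rand A) (c : ℚ) → 𝔼 D (λ _ → c) ≡ c
  𝔼-const (return x)    c = refl
  𝔼-const (uniform n d) c = begin
    sum (λ i → 𝔼 (d i) (λ _ → c)) * ((+ 1) / n)
      ≡⟨ cong (_* ((+ 1) / n)) (sum-cong-≗ (λ i → 𝔼-const (d i) c)) ⟩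
    sum {n} (λ _ → c) * ((+ 1) / n)              ≡⟨ cong (_* ((+ 1) / n)) (sum-const n c) ⟩
    ι n * c * ((+ 1) / n)
      ≡⟨ solve 3 (λ x y z → x :* y :* z := y :* (x :* z)) refl (ι n) c ((+ 1) / n) ⟩
    c * (ι n * ((+ 1) / n))                      ≡⟨ cong (c *_) (ι*1/ n) ⟩
    c * 1ℚ                                       ≡⟨ ℚ.*-identityʳ c ⟩
    c                                            ∎
    where
    open ≡-Reasoning
    open +-*-Solver

  𝔼-+ : (D : Rand A) (f g : A → ℚ) → 𝔼 D (λ x → f x + g x) ≡ 𝔼 D f + 𝔼 D g
  𝔼-+ (return x)    f g = refl
  𝔼-+ (uniform n d) f g = begin
    sum (λ i → 𝔼 (d i) (λ x → f x + g x)) * u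
      ≡⟨ cong (_* u) (sum-cong-≗ (λ i → 𝔼-+ (d i) f g)) ⟩
    sum (λ i → 𝔼 (d i) f + 𝔼 (d i) g) * u
      ≡⟨ cong (_* u) (∑-distrib-+ (λ i → 𝔼 (d i) f) (λ i → 𝔼 (d i) g)) ⟩
    (sum (λ i → 𝔼 (d i) f) + sum (λ i → 𝔼 (d i) g)) * u
      ≡⟨ ℚ.*-distribʳ-+ u (sum (λ i → 𝔼 (d i) f)) (sum (λ i → 𝔼 (d i) g)) ⟩
    sum (λ i → 𝔼 (d i) f) * u + sum (λ i → 𝔼 (d i) g) * u ∎
    where
    open ≡-Reasoning
    u = (+ 1) / n

  𝔼-*ˡ : (D : Rand A) (c : ℚ) (f : A → ℚ) → 𝔼 D (λ x → c * f x) ≡ c * 𝔼 D f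
  𝔼-*ˡ (return x)    c f = refl
  𝔼-*ˡ (uniform n d) c f = begin
    sum (λ i → 𝔼 (d i) (λ x → c * f x)) * u  ≡⟨ cong (_* u) (sum-cong-≗ (λ i → 𝔼-*ˡ (d i) c f)) ⟩
    sum (λ i → c * 𝔼 (d i) f) * u            ≡⟨ cong (_* u) (*-distribˡ-sum c (λ i → 𝔼 (d i) f)) ⟨
    c * sum (λ i → 𝔼 (d i) f) * u            ≡⟨ ℚ.*-assoc c _ u ⟩
    c * (sum (λ i → 𝔼 (d i) f) * u)          ∎
    where
    open ≡-Reasoning
    u = (+ 1) / n

  𝔼-*ʳ : (D : Rand A) (c : ℚ) (f : A → ℚ) → 𝔼 D (λ x → f x * c) ≡ 𝔼 D f * c
  𝔼-*ʳ D c f = trans (𝔼-cong D (λ x → ℚ.*-comm (f x) c)) (trans (𝔼-*ˡ D c f) (ℚ.*-comm c (𝔼 D f)))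

  𝔼-sum : (D : Rand A) {n : ℕ} (f : Fin n → A → ℚ) →
    𝔼 D (λ x → sum (λ i → f i x)) ≡ sum (λ i → 𝔼 D (f i))
  𝔼-sum D {zero}  f = 𝔼-const D 0ℚ
  𝔼-sum D {suc n} f = trans (𝔼-+ D (f zero) (λ x → sum (λ i → f (suc i) x)))
                            (cong (λ s → 𝔼 D (f zero) + s) (𝔼-sum D (f ∘ suc)))

  𝔼-swap : (D : Rand A) (D′ : Rand B) (f : A → B → ℚ) →
           𝔼 D (λ x → 𝔼 D′ (f x)) ≡ 𝔼 D′ (λ y → 𝔼 D (λ x → f x y))
  𝔼-swap (return x)    D′ f = refl
  𝔼-swap (uniform n d) D′ f = begin
    sum (λ i → 𝔼 (d i) (λ x → 𝔼 D′ (f x))) * u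
      ≡⟨ cong (_* u) (sum-cong-≗ (λ i → 𝔼-swap (d i) D′ f)) ⟩
    sum (λ i → 𝔼 D′ (λ y → 𝔼 (d i) (λ x → f x y))) * u
      ≡⟨ cong (_* u) (𝔼-sum D′ (λ i y → 𝔼 (d i) (λ x → f x y))) ⟨
    𝔼 D′ (λ y → sum (λ i → 𝔼 (d i) (λ x → f x y))) * u    ≡⟨ 𝔼-*ʳ D′ u _ ⟨
    𝔼 D′ (λ y → sum (λ i → 𝔼 (d i) (λ x → f x y)) * u)    ∎
    where
    open ≡-Reasoning
    u = (+ 1) / n

  𝔼-≥0 : (D : Rand A) {f : A → ℚ} → (∀ x → 0ℚ ≤ f x) → 0ℚ ≤ 𝔼 D f
  𝔼-≥0 D {f} h = subst (_≤ 𝔼 D f) (𝔼-const D 0ℚ) (𝔼-mono D h)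

  𝔼-≤ : (D : Rand A) {f : A → ℚ} {c : ℚ} → (∀ x → f x ≤ c) → 𝔼 D f ≤ c
  𝔼-≤ D {f} {c} h = subst (𝔼 D f ≤_) (𝔼-const D c) (𝔼-mono D h)

  ⊈⇒∃ : ∀ {n} {p q : Subset n} → p ⊈ q → ∃ λ i → i ∈ p × i ∉ q
  ⊈⇒∃ {p = p} {q} p⊈q with Fin.any? (λ i → (i ∈? p) ×-dec ¬? (i ∈? q))
  ... | yes witness = witness
  ... | no  none    = contradiction
    (λ {i} i∈p → decidable-stable (i ∈? q) (λ i∉q → none (i , i∈p , i∉q))) p⊈q

  𝔼-iid-suc : ∀ {a} {A : Set a} (D : Rand A) r (f : Vec A (suc r) → ℚ) →
              𝔼 (iid D (suc r)) f ≡ 𝔼 D (λ x → 𝔼 (iid D r) (λ X → f (x ∷ X)))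
  𝔼-iid-suc D r f = trans (𝔼->>= D _ f) (𝔼-cong D (λ x → 𝔼->>= (iid D r) _ f))

  -- Averages the head innermost, so that the tail is fixed while the head is summed out.
  𝔼-iid-suc′ : ∀ {a} {A : Set a} (D : Rand A) r (f : Vec A (suc r) → ℚ) →
               𝔼 (iid D (suc r)) f ≡ 𝔼 (iid D r) (λ X → 𝔼 D (λ x → f (x ∷ X)))
  𝔼-iid-suc′ D r f = trans (𝔼-iid-suc D r f) (𝔼-swap D (iid D r) (λ x X → f (x ∷ X)))

  -- Planting as conditioning on a zero sum

  module Planting {c ℓ} (G : FiniteAbelianGroup c ℓ) where

    open FiniteAbelianGroup G renaming (_+_ to _⊕_; -_ to ⊖_)
    open AbelianGroup abelianGroup using (group) renaming
      ( ∙-cong to ⊕-cong; assoc to ⊕-assoc; comm to ⊕-comm; identityˡ to ⊕-identityˡ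
      ; inverseˡ to ⊖-inverseˡ; refl to ≈-refl; sym to ≈-sym; trans to ≈-trans)
    open GroupProperties group using (inverseˡ-unique)

    U : Rand Carrier
    U = uniformElement

    M : ℚ
    M = ι order

    ≈?-cong : ∀ {x x′ y y′} → x ≈ x′ → y ≈ y′ → (x ≈? y) ≡ (x′ ≈? y′)
    ≈?-cong x≈x′ y≈y′ =
      cong₂ (λ i j → does (i Fin.≟ j)) (Inverse.to-cong enumeration x≈x′)
        (Inverse.to-cong enumeration y≈y′)

    index-injective : ∀ {x y} → index x ≡ index y → x ≈ y
    index-injective {x} {y} eq = ≈-trans
      (≈-sym (Inverse.strictlyInverseʳ enumeration x))
      (Inverse.inverseʳ enumeration eq)

    ≈?-⇔ : ∀ {x y x′ y′} → (x ≈ y → x′ ≈ y′) → (x′ ≈ y′ → x ≈ y) → (x ≈? y) ≡ (x′ ≈? y′)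
    ≈?-⇔ {x} {y} {x′} {y′} to from = does-⇔
      (mk⇔ (Inverse.to-cong enumeration ∘ to ∘ index-injective)
           (Inverse.to-cong enumeration ∘ from ∘ index-injective))
      (index x Fin.≟ index y) (index x′ Fin.≟ index y′)

    -- `M * 𝟙 (x ≈? y)` is the density of the point mass at `y` with respect to the uniform
    -- distribution. The enumeration returns `element (index y)`, which is only `_≈_` to `y`; hence
    -- the congruence condition on `f`, and `Respects` below.
    𝔼-select : ∀ y (f : Carrier → ℚ) → (∀ {x z} → x ≈ z → f x ≡ f z) →
               𝔼 U (λ x → (M * 𝟙 (x ≈? y)) * f x) ≡ f y
    𝔼-select y f f-cong = begin
      sum (λ i → (M * 𝟙 (element i ≈? y)) * f (element i)) * u
        ≡⟨ cong (_* u) (sum-cong-≗ (λ i → trans (ℚ.*-assoc M _ _)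
             (cong (λ j → M * (𝟙 (does (j Fin.≟ index y)) * f (element i)))
                   (Inverse.strictlyInverseˡ enumeration i)))) ⟩
      sum (λ i → M * (𝟙 (does (i Fin.≟ index y)) * f (element i))) * u
        ≡⟨ cong (_* u) (*-distribˡ-sum M (λ i → 𝟙 (does (i Fin.≟ index y)) * f (element i))) ⟨
      M * sum (λ i → 𝟙 (does (i Fin.≟ index y)) * f (element i)) * u
        ≡⟨ cong (λ s → M * s * u) (sum-select (index y) (f ∘ element)) ⟩
      M * f (element (index y)) * u
        ≡⟨ solve 3 (λ m s u → m :* s :* u := (m :* u) :* s) refl M (f (element (index y))) u ⟩
      M * u * f (element (index y))
        ≡⟨ cong₂ _*_ (ι*1/ order {{order≢0}}) (f-cong (Inverse.strictlyInverseʳ enumeration y)) ⟩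
      1ℚ * f y
        ≡⟨ ℚ.*-identityˡ (f y) ⟩
      f y ∎
      where
      open ≡-Reasoning
      open +-*-Solver
      u = _/_ (+ 1) order {{order≢0}}

    -- The density of the point mass at zero, so `weight S` is the density of a sample conditioned
    -- on a zero sum over `S`.
    w : Carrier → ℚ
    w y = M * 𝟙 (y ≈? 0#)

    0≤M : 0ℚ ≤ M
    0≤M = 0≤ι order

    0≤w : ∀ y → 0ℚ ≤ w y
    0≤w y = 0≤* 0≤M (0≤𝟙 (y ≈? 0#))

    w≤M : ∀ y → w y ≤ M
    w≤M y = ℚ.≤-trans (*-monoˡ M 0≤M (𝟙≤1 (y ≈? 0#))) (ℚ.≤-reflexive (ℚ.*-identityʳ M))

    w-cong : ∀ {x y} → x ≈ y → w x ≡ w y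
    w-cong x≈y = cong (λ b → M * 𝟙 b) (≈?-cong x≈y ≈-refl)

    w-⊕ : ∀ x h → w (x ⊕ h) ≡ M * 𝟙 (x ≈? ⊖ h)
    w-⊕ x h = cong (λ b → M * 𝟙 b)
      (≈?-⇔ (inverseˡ-unique x h) (λ x≈⊖h → ≈-trans (⊕-cong x≈⊖h ≈-refl) (⊖-inverseˡ h)))

    𝔼-w-⊕ : ∀ h (f : Carrier → ℚ) → (∀ {x z} → x ≈ z → f x ≡ f z) →
            𝔼 U (λ x → w (x ⊕ h) * f x) ≡ f (⊖ h)
    𝔼-w-⊕ h f f-cong = trans (𝔼-cong U (λ x → cong (_* f x) (w-⊕ x h))) (𝔼-select (⊖ h) f f-cong)

    weight : ∀ {r} → Subset r → Vec Carrier r → ℚ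
    weight S X = w (subsetSum G S X)

    Respects : ∀ {r} → (Vec Carrier r → ℚ) → Set _
    Respects f = ∀ {X Y} → Pointwise _≈_ X Y → f X ≡ f Y

    Pointwise-refl : ∀ {r} {X : Vec Carrier r} → Pointwise _≈_ X X
    Pointwise-refl {X = []}    = []
    Pointwise-refl {X = x ∷ X} = ≈-refl ∷ Pointwise-refl

    subsetSum-cong : ∀ {r} (S : Subset r) {X Y} → Pointwise _≈_ X Y →
      subsetSum G S X ≈ subsetSum G S Y
    subsetSum-cong []            []          = ≈-refl
    subsetSum-cong (inside  ∷ S) (x≈y ∷ X≈Y) = ⊕-cong x≈y (subsetSum-cong S X≈Y)
    subsetSum-cong (outside ∷ S) (x≈y ∷ X≈Y) = subsetSum-cong S X≈Y

    -- For a fixed tail, averaging against the weight evaluates `f` at the one head that makes the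
    -- sum vanish, and this head is what `plant` inserts. Positions before the minimum of `S` are
    -- passed over by induction. An empty `S` would fail: planting then changes nothing, while the
    -- weight is constantly `M`.
    𝔼-plant : ∀ {r} (S : Subset r) → Nonempty S → (f : Vec Carrier r → ℚ) → Respects f →
              𝔼 (D₀ G r) (f ∘ plant G S) ≡ 𝔼 (D₀ G r) (λ X → weight S X * f X)
    𝔼-plant {suc r} (inside ∷ S) _ f f-cong = begin
      𝔼 (D₀ G (suc r)) (f ∘ plant G (inside ∷ S))
        ≡⟨ 𝔼-iid-suc U r _ ⟩
      𝔼 U (λ x → 𝔼 (D₀ G r) (λ X → f (⊖ subsetSum G S X ∷ X)))
        ≡⟨ 𝔼-const U _ ⟩
      𝔼 (D₀ G r) (λ X → f (⊖ subsetSum G S X ∷ X))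
        ≡⟨ 𝔼-cong (D₀ G r)
          (λ X → 𝔼-w-⊕ (subsetSum G S X) (λ x → f (x ∷ X))
            (λ x≈z → f-cong (x≈z ∷ Pointwise-refl))) ⟨
      𝔼 (D₀ G r) (λ X → 𝔼 U (λ x → weight (inside ∷ S) (x ∷ X) * f (x ∷ X)))
        ≡⟨ 𝔼-iid-suc′ U r _ ⟨
      𝔼 (D₀ G (suc r)) (λ X → weight (inside ∷ S) X * f X) ∎
      where open ≡-Reasoning
    𝔼-plant {suc r} (outside ∷ S) (suc i , there i∈S) f f-cong = begin
      𝔼 (D₀ G (suc r)) (f ∘ plant G (outside ∷ S))
        ≡⟨ 𝔼-iid-suc U r _ ⟩
      𝔼 U (λ x → 𝔼 (D₀ G r) (λ X → f (x ∷ plant G S X)))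
        ≡⟨ 𝔼-cong U
          (λ x → 𝔼-plant S (i , i∈S) (λ X → f (x ∷ X)) (λ X≈Y → f-cong (≈-refl ∷ X≈Y))) ⟩
      𝔼 U (λ x → 𝔼 (D₀ G r) (λ X → weight S X * f (x ∷ X)))
        ≡⟨ 𝔼-iid-suc U r _ ⟨
      𝔼 (D₀ G (suc r)) (λ X → weight (outside ∷ S) X * f X) ∎
      where open ≡-Reasoning

    Ignores : ∀ {r} → Fin r → (Vec Carrier r → ℚ) → Set _
    Ignores i f = ∀ X x → f (X [ i ]≔ x) ≡ f X

    subsetSum-update : ∀ {r} {S : Subset r} {i} → i ∉ S → ∀ X x →
      subsetSum G S (X [ i ]≔ x) ≡ subsetSum G S X
    subsetSum-update {S = inside  ∷ S} {zero}  i∉S (y ∷ X) x = contradiction here i∉S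
    subsetSum-update {S = outside ∷ S} {zero}  i∉S (y ∷ X) x = refl
    subsetSum-update {S = inside  ∷ S} {suc i} i∉S (y ∷ X) x =
      cong (y ⊕_) (subsetSum-update (i∉S ∘ there) X x)
    subsetSum-update {S = outside ∷ S} {suc i} i∉S (y ∷ X) x = subsetSum-update (i∉S ∘ there) X x

    weight-ignores : ∀ {r} {S : Subset r} {i} → i ∉ S → Ignores i (weight S)
    weight-ignores i∉S X x = cong w (subsetSum-update i∉S X x)

    -- The shift g collects the elements at the positions of S that precede i.
    𝔼-shiftedWeight : ∀ {r} {S : Subset r} {i} → i ∈ S →
                      ∀ g (f : Vec Carrier r → ℚ) → Ignores i f →
                      𝔼 (D₀ G r) (λ X → w (g ⊕ subsetSum G S X) * f X) ≡ 𝔼 (D₀ G r) f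
    𝔼-shiftedWeight {suc r} {inside ∷ S} here g f ignores = begin
      𝔼 (D₀ G (suc r)) (λ X → w (g ⊕ subsetSum G (inside ∷ S) X) * f X)
        ≡⟨ 𝔼-iid-suc′ U r _ ⟩
      𝔼 (D₀ G r) (λ X → 𝔼 U (λ x → w (g ⊕ (x ⊕ subsetSum G S X)) * f (x ∷ X)))
        -- As `f` ignores the head, its head can be frozen at `0#`; the weight alone then averages
        -- to 1 over `x`.
        ≡⟨ 𝔼-cong (D₀ G r)
          (λ X → 𝔼-cong U
            (λ x → cong₂ _*_ (w-cong (exchange x (subsetSum G S X))) (ignores (0# ∷ X) x))) ⟩
      𝔼 (D₀ G r) (λ X → 𝔼 U (λ x → w (x ⊕ (g ⊕ subsetSum G S X)) * f (0# ∷ X)))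
        ≡⟨ 𝔼-cong (D₀ G r) (λ X → 𝔼-w-⊕ (g ⊕ subsetSum G S X) (λ _ → f (0# ∷ X)) (λ _ → refl)) ⟩
      𝔼 (D₀ G r) (λ X → f (0# ∷ X))
        ≡⟨ 𝔼-const U _ ⟨
      𝔼 U (λ x → 𝔼 (D₀ G r) (λ X → f (0# ∷ X)))
        ≡⟨ 𝔼-cong U (λ x → 𝔼-cong (D₀ G r) (λ X → ignores (0# ∷ X) x)) ⟨
      𝔼 U (λ x → 𝔼 (D₀ G r) (λ X → f (x ∷ X)))
        ≡⟨ 𝔼-iid-suc U r f ⟨
      𝔼 (D₀ G (suc r)) f ∎
      where
      open ≡-Reasoning
      exchange : ∀ x s → g ⊕ (x ⊕ s) ≈ x ⊕ (g ⊕ s)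
      exchange x s =
        ≈-trans (≈-sym (⊕-assoc g x s)) (≈-trans (⊕-cong (⊕-comm g x) ≈-refl) (⊕-assoc x g s))
    𝔼-shiftedWeight {suc r} {inside ∷ S} (there i∈S) g f ignores = begin
      𝔼 (D₀ G (suc r)) (λ X → w (g ⊕ subsetSum G (inside ∷ S) X) * f X)
        ≡⟨ 𝔼-iid-suc U r _ ⟩
      𝔼 U (λ x → 𝔼 (D₀ G r) (λ X → w (g ⊕ (x ⊕ subsetSum G S X)) * f (x ∷ X)))
        ≡⟨ 𝔼-cong U
          (λ x → 𝔼-cong (D₀ G r)
            (λ X → cong (_* f (x ∷ X)) (w-cong (≈-sym (⊕-assoc g x (subsetSum G S X)))))) ⟩
      𝔼 U (λ x → 𝔼 (D₀ G r) (λ X → w ((g ⊕ x) ⊕ subsetSum G S X) * f (x ∷ X)))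
        ≡⟨ 𝔼-cong U
          (λ x → 𝔼-shiftedWeight i∈S (g ⊕ x) (λ X → f (x ∷ X)) (λ X → ignores (x ∷ X))) ⟩
      𝔼 U (λ x → 𝔼 (D₀ G r) (λ X → f (x ∷ X)))
        ≡⟨ 𝔼-iid-suc U r f ⟨
      𝔼 (D₀ G (suc r)) f ∎
      where open ≡-Reasoning
    𝔼-shiftedWeight {suc r} {outside ∷ S} (there i∈S) g f ignores = begin
      𝔼 (D₀ G (suc r)) (λ X → w (g ⊕ subsetSum G (outside ∷ S) X) * f X)
        ≡⟨ 𝔼-iid-suc U r _ ⟩
      𝔼 U (λ x → 𝔼 (D₀ G r) (λ X → w (g ⊕ subsetSum G S X) * f (x ∷ X)))
        ≡⟨ 𝔼-cong U (λ x → 𝔼-shiftedWeight i∈S g (λ X → f (x ∷ X)) (λ X → ignores (x ∷ X))) ⟩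
      𝔼 U (λ x → 𝔼 (D₀ G r) (λ X → f (x ∷ X)))
        ≡⟨ 𝔼-iid-suc U r f ⟨
      𝔼 (D₀ G (suc r)) f ∎
      where open ≡-Reasoning

    -- The element at `i` is uniform and does not enter `f`, so it makes the sum over `S` uniform
    -- whatever `f` sees.
    𝔼-weight : ∀ {r} {S : Subset r} {i} → i ∈ S → (f : Vec Carrier r → ℚ) → Ignores i f →
               𝔼 (D₀ G r) (λ X → weight S X * f X) ≡ 𝔼 (D₀ G r) f
    𝔼-weight {r} {S} i∈S f ignores = trans
      (𝔼-cong (D₀ G r) (λ X → cong (_* f X) (w-cong (≈-sym (⊕-identityˡ (subsetSum G S X))))))
      (𝔼-shiftedWeight i∈S 0# f ignores)

    𝔼-weight≡1 : ∀ {r} {S : Subset r} → Nonempty S → 𝔼 (D₀ G r) (weight S) ≡ 1ℚ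
    𝔼-weight≡1 {r} {S} (i , i∈S) = begin
      𝔼 (D₀ G r) (weight S)
        ≡⟨ 𝔼-cong (D₀ G r) (λ X → sym (ℚ.*-identityʳ (weight S X))) ⟩
      𝔼 (D₀ G r) (λ X → weight S X * 1ℚ)       ≡⟨ 𝔼-weight i∈S (λ _ → 1ℚ) (λ _ _ → refl) ⟩
      𝔼 (D₀ G r) (λ _ → 1ℚ)                    ≡⟨ 𝔼-const (D₀ G r) 1ℚ ⟩
      1ℚ                                       ∎
      where open ≡-Reasoning

    -- Bounds the factor by which conditioning on a zero sum over S increases the mean of a
    -- nonnegative function of the coordinates in T.
    correlation : ∀ {r} → Subset r → Subset r → ℚ
    correlation S T = 1ℚ + M * 𝟙 (does (S ⊆? T))

    0≤correlation : ∀ {r} (S T : Subset r) → 0ℚ ≤ correlation S T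
    0≤correlation S T = 0≤+ 0≤1 (0≤* 0≤M (0≤𝟙 (does (S ⊆? T))))

    -- An element of `S` outside `T` makes the weight independent of `f`; if there is none, `w≤M` is
    -- the crude bound. Allowing `1 + M` instead of `M` keeps `correlation` affine in the indicator,
    -- so that its average over k-subsets is a count.
    𝔼-weight-≤ : ∀ {r} (S T : Subset r) (f : Vec Carrier r → ℚ) →
                 (∀ X → 0ℚ ≤ f X) → (∀ {i} → i ∉ T → Ignores i f) →
                 𝔼 (D₀ G r) (λ X → weight S X * f X) ≤ correlation S T * 𝔼 (D₀ G r) f
    𝔼-weight-≤ {r} S T f 0≤f ignores with S ⊆? T
    ... | no S⊈T = ℚ.≤-reflexive (begin
      𝔼 (D₀ G r) (λ X → weight S X * f X)
        ≡⟨ 𝔼-weight (proj₁ (proj₂ witness)) f (ignores (proj₂ (proj₂ witness))) ⟩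
      𝔼 (D₀ G r) f                         ≡⟨ ℚ.*-identityˡ _ ⟨
      1ℚ * 𝔼 (D₀ G r) f                    ≡⟨ cong (λ z → (1ℚ + z) * 𝔼 (D₀ G r) f) (ℚ.*-zeroʳ M) ⟨
      (1ℚ + M * 0ℚ) * 𝔼 (D₀ G r) f         ∎)
      where
      open ≡-Reasoning
      witness = ⊈⇒∃ S⊈T
    ... | yes _ = begin
      𝔼 (D₀ G r) (λ X → weight S X * f X)
        ≤⟨ 𝔼-mono (D₀ G r) (λ X → *-monoʳ (f X) (0≤f X) (w≤M (subsetSum G S X))) ⟩
      𝔼 (D₀ G r) (λ X → M * f X)           ≡⟨ 𝔼-*ˡ (D₀ G r) M f ⟩
      M * 𝔼 (D₀ G r) f                     ≤⟨ *-monoʳ (𝔼 (D₀ G r) f) (𝔼-≥0 (D₀ G r) 0≤f) M≤1+M ⟩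
      (1ℚ + M * 1ℚ) * 𝔼 (D₀ G r) f         ∎
      where
      open ℚ.≤-Reasoning
      M≤1+M : M ≤ 1ℚ + M * 1ℚ
      M≤1+M = subst₂ _≤_ (ℚ.+-identityˡ M) (cong (λ m → 1ℚ + m) (sym (ℚ.*-identityʳ M)))
        (ℚ.+-monoˡ-≤ M 0≤1)

    -- The product of the weights of `S` and `T` depends only on the coordinates in `S ∪ T`, so `V`
    -- is peeled off against that union, then `S` against `T`; the mean that remains is 1.
    𝔼-weight₃-≤ : ∀ {r} (S T V : Subset r) → Nonempty T →
                  𝔼 (D₀ G r) (λ X → weight V X * (weight S X * weight T X)) ≤
                  correlation V (S ∪ T) * correlation S T
    𝔼-weight₃-≤ {r} S T V T≢∅ = begin
      𝔼 (D₀ G r) (λ X → weight V X * (weight S X * weight T X))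
        ≤⟨ 𝔼-weight-≤ V (S ∪ T) _ (λ X → 0≤* (0≤w (subsetSum G S X)) (0≤w (subsetSum G T X)))
             (λ i∉S∪T X x → cong₂ _*_ (weight-ignores (i∉S∪T ∘ x∈p∪q⁺ ∘ inj₁) X x)
               (weight-ignores (i∉S∪T ∘ x∈p∪q⁺ ∘ inj₂) X x)) ⟩
      correlation V (S ∪ T) * 𝔼 (D₀ G r) (λ X → weight S X * weight T X)
        ≤⟨ *-monoˡ _ (0≤correlation V (S ∪ T))
          (𝔼-weight-≤ S T (weight T) (λ X → 0≤w (subsetSum G T X)) weight-ignores) ⟩
      correlation V (S ∪ T) * (correlation S T * 𝔼 (D₀ G r) (weight T))
        ≡⟨ cong (λ e → correlation V (S ∪ T) * (correlation S T * e)) (𝔼-weight≡1 T≢∅) ⟩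
      correlation V (S ∪ T) * (correlation S T * 1ℚ)
        ≡⟨ cong (correlation V (S ∪ T) *_) (ℚ.*-identityʳ (correlation S T)) ⟩
      correlation V (S ∪ T) * correlation S T ∎
      where open ℚ.≤-Reasoning

  𝔼-cong-Always : ∀ {a} {A : Set a} {P : A → Set} (D : Rand A) {f g : A → ℚ} → Always P D →
                  (∀ x → P x → f x ≡ g x) → 𝔼 D f ≡ 𝔼 D g
  𝔼-cong-Always D always h = ℚ.≤-antisym
    (𝔼-mono-Always D always (λ x p → ℚ.≤-reflexive (h x p)))
    (𝔼-mono-Always D always (λ x p → ℚ.≤-reflexive (sym (h x p))))

  -- Counting k-subsets

  module _ {a} {A : Set a} where

    count : (A → Bool) → List A → ℕ
    count E []       = 0
    count E (x ∷ xs) = (if E x then 1 else 0) ℕ.+ count E xs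

    count-++ : ∀ E xs ys → count E (xs ++ ys) ≡ count E xs ℕ.+ count E ys
    count-++ E []       ys = refl
    count-++ E (x ∷ xs) ys = trans (cong ((if E x then 1 else 0) ℕ.+_) (count-++ E xs ys))
      (sym (ℕ.+-assoc (if E x then 1 else 0) (count E xs) (count E ys)))

    count-none : ∀ xs → count (λ _ → false) xs ≡ 0
    count-none []       = refl
    count-none (x ∷ xs) = count-none xs

    sum-lookup : ∀ E xs → sum (λ i → 𝟙 (E (lookup xs i))) ≡ ι (count E xs)
    sum-lookup E []       = sym ι0≡0
    sum-lookup E (x ∷ xs) =
      trans (cong₂ _+_ (𝟙≡ι (E x)) (sum-lookup E xs)) (sym (ι-+ _ (count E xs)))
      where
      𝟙≡ι : ∀ b → 𝟙 b ≡ ι (if b then 1 else 0)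
      𝟙≡ι true  = sym ι1≡1
      𝟙≡ι false = sym ι0≡0

    𝔼-choose : ∀ E xs .{{_ : NonZero (length xs)}} →
               𝔼 (choose xs) (𝟙 ∘ E) ≡ ι (count E xs) * ((+ 1) / length xs)
    𝔼-choose E xs = cong (_* ((+ 1) / length xs)) (sum-lookup E xs)

    Always-choose : ∀ {P : A → Set} {xs} .{{_ : NonZero (length xs)}} → All P xs →
      Always P (choose xs)
    Always-choose {xs = xs} all i = All.lookup all (∈-lookup {xs = xs} i)

  count-map : ∀ {a b} {A : Set a} {B : Set b} (E : B → Bool) (f : A → B) xs →
    count E (map f xs) ≡ count (E ∘ f) xs
  count-map E f []       = refl
  count-map E f (x ∷ xs) = cong ((if E (f x) then 1 else 0) ℕ.+_) (count-map E f xs)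

  -- The binomial coefficient C(r, k), read off the list so that it is literally the denominator in
  -- `choose`.
  #kSubsets : ℕ → ℕ → ℕ
  #kSubsets r k = length (kSubsets r k)

  #kSubsets-pascal : ∀ r k → #kSubsets (suc r) (suc k) ≡ #kSubsets r k ℕ.+ #kSubsets r (suc k)
  #kSubsets-pascal r k = trans (length-++ (map (inside ∷_) (kSubsets r k)))
    (cong₂ ℕ._+_ (length-map (inside ∷_) (kSubsets r k))
      (length-map (outside ∷_) (kSubsets r (suc k))))

  #kSubsets-0 : ∀ r → #kSubsets r 0 ≡ 1
  #kSubsets-0 zero    = refl
  #kSubsets-0 (suc r) = refl

  #kSubsets-< : ∀ {r k} → r ℕ.< k → #kSubsets r k ≡ 0
  #kSubsets-< {zero}  {suc k} _           = refl
  #kSubsets-< {suc r} {suc k} (ℕ.s≤s r<k) = trans (#kSubsets-pascal r k)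
    (cong₂ ℕ._+_ (#kSubsets-< r<k) (#kSubsets-< (ℕ.m<n⇒m<1+n r<k)))

  #kSubsets-self : ∀ k → #kSubsets k k ≡ 1
  #kSubsets-self zero    = refl
  #kSubsets-self (suc k) = trans (#kSubsets-pascal k k)
    (cong₂ ℕ._+_ (#kSubsets-self k) (#kSubsets-< {k} {suc k} ℕ.≤-refl))

  #kSubsets-≤-2^ : ∀ r k → #kSubsets r k ℕ.≤ 2 ℕ.^ r
  #kSubsets-≤-2^ zero    zero    = ℕ.≤-refl
  #kSubsets-≤-2^ zero    (suc k) = ℕ.z≤n
  #kSubsets-≤-2^ (suc r) zero    = ℕ.m^n>0 2 (suc r)
  #kSubsets-≤-2^ (suc r) (suc k) = ℕ.≤-trans (ℕ.≤-reflexive (#kSubsets-pascal r k))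
    (ℕ.+-mono-≤ (#kSubsets-≤-2^ r k) (ℕ.≤-trans (#kSubsets-≤-2^ r (suc k)) (ℕ.m≤m+n _ 0)))

  count-⊆ : ∀ {r} (W : Subset r) k →
    count (λ S → does (S ⊆? W)) (kSubsets r k) ≡ #kSubsets ∣ W ∣ k
  count-⊆ {zero}  []            zero    = refl
  count-⊆ {zero}  []            (suc k) = refl
  count-⊆ {suc r} W             zero    = trans
    (cong (λ b → (if b then 1 else 0) ℕ.+ 0) (dec-true (∅ ⊆? W) ⊥⊆)) (sym (#kSubsets-0 ∣ W ∣))
  count-⊆ {suc r} (inside ∷ W)  (suc k) = begin
    count ⊆W (map (inside ∷_) (kSubsets r k) ++ map (outside ∷_) (kSubsets r (suc k)))
      ≡⟨ count-++ ⊆W (map (inside ∷_) (kSubsets r k)) _ ⟩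
    count ⊆W (map (inside ∷_) (kSubsets r k)) ℕ.+ count ⊆W (map (outside ∷_) (kSubsets r (suc k)))
      ≡⟨ cong₂ ℕ._+_ (trans (count-map ⊆W (inside ∷_) (kSubsets r k)) (count-⊆ W k))
                     (trans (count-map ⊆W (outside ∷_) (kSubsets r (suc k)))
                       (count-⊆ W (suc k))) ⟩
    (#kSubsets ∣ W ∣ k) ℕ.+ (#kSubsets ∣ W ∣ (suc k))
      ≡⟨ #kSubsets-pascal ∣ W ∣ k ⟨
    #kSubsets (suc ∣ W ∣) (suc k) ∎
    where
    open ≡-Reasoning
    ⊆W = λ S → does (S ⊆? (inside ∷ W))
  count-⊆ {suc r} (outside ∷ W) (suc k) = begin
    count ⊆W (map (inside ∷_) (kSubsets r k) ++ map (outside ∷_) (kSubsets r (suc k)))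
      ≡⟨ count-++ ⊆W (map (inside ∷_) (kSubsets r k)) _ ⟩
    count ⊆W (map (inside ∷_) (kSubsets r k)) ℕ.+ count ⊆W (map (outside ∷_) (kSubsets r (suc k)))
      -- A set that contains the head is not contained in `outside ∷ W`, and the test on it computes
      -- to `false`.
      ≡⟨ cong₂ ℕ._+_ (trans (count-map ⊆W (inside ∷_) (kSubsets r k)) (count-none (kSubsets r k)))
                     (trans (count-map ⊆W (outside ∷_) (kSubsets r (suc k)))
                       (count-⊆ W (suc k))) ⟩
    #kSubsets ∣ W ∣ (suc k) ∎
    where
    open ≡-Reasoning
    ⊆W = λ S → does (S ⊆? (outside ∷ W))

  ∣kSubsets∣ : ∀ r k → All (λ S → ∣ S ∣ ≡ k) (kSubsets r k)
  ∣kSubsets∣ zero    zero    = refl ∷ []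
  ∣kSubsets∣ zero    (suc k) = []
  ∣kSubsets∣ (suc r) zero    = ∣⊥∣≡0 (suc r) ∷ []
  ∣kSubsets∣ (suc r) (suc k) = All.++⁺
    (All.map⁺ (All.map (cong suc) (∣kSubsets∣ r k)))
    (All.map⁺ (∣kSubsets∣ r (suc k)))

  ∣∪∣-≤ : ∀ {r} (S T : Subset r) → ∣ S ∪ T ∣ ℕ.≤ ∣ S ∣ ℕ.+ ∣ T ∣
  ∣∪∣-≤ []            []            = ℕ.z≤n
  ∣∪∣-≤ (inside  ∷ S) (inside  ∷ T) =
    ℕ.s≤s (ℕ.≤-trans (∣∪∣-≤ S T) (ℕ.+-monoʳ-≤ ∣ S ∣ (ℕ.n≤1+n ∣ T ∣)))
  ∣∪∣-≤ (inside  ∷ S) (outside ∷ T) = ℕ.s≤s (∣∪∣-≤ S T)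
  ∣∪∣-≤ (outside ∷ S) (inside  ∷ T) =
    ℕ.≤-trans (ℕ.s≤s (∣∪∣-≤ S T)) (ℕ.≤-reflexive (sym (ℕ.+-suc ∣ S ∣ ∣ T ∣)))
  ∣∪∣-≤ (outside ∷ S) (outside ∷ T) = ∣∪∣-≤ S T

  ⊆⇒∪≡ : ∀ {r} {S T : Subset r} → S ⊆ T → S ∪ T ≡ T
  ⊆⇒∪≡ {S = S} {T} S⊆T = ⊆-antisym (λ i∈S∪T → [ S⊆T , id ]′ (x∈p∪q⁻ S T i∈S∪T)) (q⊆p∪q S T)

  ∣∣>0⇒Nonempty : ∀ {r} (S : Subset r) → 0 ℕ.< ∣ S ∣ → Nonempty S
  ∣∣>0⇒Nonempty (inside  ∷ S) _     = zero , here
  ∣∣>0⇒Nonempty (outside ∷ S) 0<∣S∣ = let (i , i∈S) = ∣∣>0⇒Nonempty S 0<∣S∣ in suc i , there i∈S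

  -- The likelihood ratio and its third moment

  module ThirdMoment {c ℓ} (G : FiniteAbelianGroup c ℓ) {k r : ℕ} (k≤r : k ℕ.≤ r) (0<k : 0 ℕ.< k)
    where

    open FiniteAbelianGroup G using (Carrier)
    open Planting G

    instance
      #kSubsets≢0 : NonZero (length (kSubsets r k))
      #kSubsets≢0 = kSubsets-nonEmpty k≤r

    K : Rand (Subset r)
    K = choose (kSubsets r k)

    size : Always (λ S → ∣ S ∣ ≡ k) K
    size = Always-choose (∣kSubsets∣ r k)

    nonempty : ∀ {S : Subset r} → ∣ S ∣ ≡ k → Nonempty S
    nonempty {S} ∣S∣≡k = ∣∣>0⇒Nonempty S (subst (0 ℕ.<_) (sym ∣S∣≡k) 0<k)

    ρ : ℚ
    ρ = M * ((+ 1) / #kSubsets r k)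

    0≤ρ : 0ℚ ≤ ρ
    0≤ρ = 0≤* 0≤M (0≤1/ (#kSubsets r k))

    likelihoodRatio : Vec Carrier r → ℚ
    likelihoodRatio X = 𝔼 K (λ S → weight S X)

    0≤likelihoodRatio : ∀ X → 0ℚ ≤ likelihoodRatio X
    0≤likelihoodRatio X = 𝔼-≥0 K (λ S → 0≤w (subsetSum G S X))

    𝔼-D₁ : (f : Vec Carrier r → ℚ) → Respects f →
           𝔼 (D₁ G k r k≤r) f ≡ 𝔼 (D₀ G r) (λ X → likelihoodRatio X * f X)
    𝔼-D₁ f f-cong = begin
      𝔼 (D₁ G k r k≤r) f
        ≡⟨ 𝔼->>= (D₀ G r) _ f ⟩
      𝔼 (D₀ G r) (λ X → 𝔼 (K >>= λ S → return (plant G S X)) f)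
        ≡⟨ 𝔼-cong (D₀ G r) (λ X → 𝔼->>= K (λ S → return (plant G S X)) f) ⟩
      𝔼 (D₀ G r) (λ X → 𝔼 K (λ S → f (plant G S X)))
        ≡⟨ 𝔼-swap (D₀ G r) K (λ X S → f (plant G S X)) ⟩
      𝔼 K (λ S → 𝔼 (D₀ G r) (λ X → f (plant G S X)))
        ≡⟨ 𝔼-cong-Always K size (λ S ∣S∣≡k → 𝔼-plant S (nonempty ∣S∣≡k) f f-cong) ⟩
      𝔼 K (λ S → 𝔼 (D₀ G r) (λ X → weight S X * f X))
        ≡⟨ 𝔼-swap (D₀ G r) K (λ X S → weight S X * f X) ⟨
      𝔼 (D₀ G r) (λ X → 𝔼 K (λ S → weight S X * f X))
        ≡⟨ 𝔼-cong (D₀ G r) (λ X → 𝔼-*ʳ K (f X) (λ S → weight S X)) ⟩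
      𝔼 (D₀ G r) (λ X → likelihoodRatio X * f X) ∎
      where open ≡-Reasoning

    -- A uniform k-subset lies in `W` with probability C(∣W∣, k) / N.
    𝔼-correlation : ∀ W → 𝔼 K (λ V → correlation V W) ≡ 1ℚ + ρ * ι (#kSubsets ∣ W ∣ k)
    𝔼-correlation W = begin
      𝔼 K (λ V → 1ℚ + M * 𝟙 (does (V ⊆? W)))
        ≡⟨ 𝔼-+ K (λ _ → 1ℚ) (λ V → M * 𝟙 (does (V ⊆? W))) ⟩
      𝔼 K (λ _ → 1ℚ) + 𝔼 K (λ V → M * 𝟙 (does (V ⊆? W)))
        ≡⟨ cong₂ _+_ (𝔼-const K 1ℚ) (𝔼-*ˡ K M (λ V → 𝟙 (does (V ⊆? W)))) ⟩
      1ℚ + M * 𝔼 K (λ V → 𝟙 (does (V ⊆? W)))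
        ≡⟨ cong (λ e → 1ℚ + M * e) (𝔼-choose (λ V → does (V ⊆? W)) (kSubsets r k)) ⟩
      1ℚ + M * (ι (count (λ V → does (V ⊆? W)) (kSubsets r k)) * ((+ 1) / #kSubsets r k))
        ≡⟨ cong (λ n → 1ℚ + M * (ι n * ((+ 1) / #kSubsets r k))) (count-⊆ W k) ⟩
      1ℚ + M * (ι (#kSubsets ∣ W ∣ k) * ((+ 1) / #kSubsets r k))
        ≡⟨ cong (λ p → 1ℚ + p) (solve 3 (λ m n u → m :* (n :* u) := m :* u :* n)
          refl M (ι (#kSubsets ∣ W ∣ k)) ((+ 1) / #kSubsets r k)) ⟩
      1ℚ + ρ * ι (#kSubsets ∣ W ∣ k) ∎
      where
      open ≡-Reasoning
      open +-*-Solver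

    -- The ratio is an average of weights, so its cube is an average over three independent draws.
    -- `V` is innermost because its correlation with `S ∪ T` is averaged first, for fixed `S` and
    -- `T`.
    likelihoodRatio³ : ∀ X → likelihoodRatio X * (likelihoodRatio X * likelihoodRatio X) ≡
      𝔼 K (λ T → 𝔼 K (λ S → 𝔼 K (λ V → weight V X * (weight S X * weight T X))))
    likelihoodRatio³ X = sym (begin
      𝔼 K (λ T → 𝔼 K (λ S → 𝔼 K (λ V → weight V X * (weight S X * weight T X))))
        ≡⟨ 𝔼-cong K (λ T → 𝔼-cong K (λ S → 𝔼-*ʳ K (weight S X * weight T X) (λ V → weight V X))) ⟩
      𝔼 K (λ T → 𝔼 K (λ S → L * (weight S X * weight T X)))
        ≡⟨ 𝔼-cong K (λ T → trans (𝔼-*ˡ K L (λ S → weight S X * weight T X))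
                                 (cong (L *_) (𝔼-*ʳ K (weight T X) (λ S → weight S X)))) ⟩
      𝔼 K (λ T → L * (L * weight T X))
        ≡⟨ trans (𝔼-*ˡ K L (λ T → L * weight T X)) (cong (L *_) (𝔼-*ˡ K L (λ T → weight T X))) ⟩
      L * (L * L) ∎)
      where
      open ≡-Reasoning
      L = likelihoodRatio X

    -- 4ᵏ, which bounds the number of k-subsets of a union of two k-sets.
    β : ℚ
    β = ι (2 ℕ.^ (k ℕ.+ k))

    -- For S ⊆ T the union is `T`, whose only k-subset is `T` itself, so the first factor drops to
    -- `1 + ρ`. This saving matters: with `1 + ρ * β` in front of the indicator as well, averaging
    -- would leave a term ρ²β, which the estimates below bound only by order k^(3k). Both cases fit
    -- one expression affine in the indicator, ready to be averaged over `S`.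
    correlation-≤ : ∀ {S T : Subset r} → ∣ S ∣ ≡ k → ∣ T ∣ ≡ k →
      (1ℚ + ρ * ι (#kSubsets ∣ S ∪ T ∣ k)) * correlation S T ≤
      (1ℚ + ρ * β) + (1ℚ + ρ) * (M * 𝟙 (does (S ⊆? T)))
    correlation-≤ {S} {T} ∣S∣≡k ∣T∣≡k with S ⊆? T
    ... | no _ = begin
      (1ℚ + ρ * ι (#kSubsets ∣ S ∪ T ∣ k)) * (1ℚ + M * 0ℚ)
        ≡⟨ solve 2 (λ p m → p :* (con 1ℚ :+ m :* con 0ℚ) := p)
          refl (1ℚ + ρ * ι (#kSubsets ∣ S ∪ T ∣ k)) M ⟩
      1ℚ + ρ * ι (#kSubsets ∣ S ∪ T ∣ k)
        ≤⟨ ℚ.+-monoʳ-≤ 1ℚ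
          (*-monoˡ ρ 0≤ρ
            (ι-mono (ℕ.≤-trans (#kSubsets-≤-2^ ∣ S ∪ T ∣ k) (ℕ.^-monoʳ-≤ 2 ∣S∪T∣≤)))) ⟩
      1ℚ + ρ * β
        ≡⟨ solve 3 (λ p q m → p := p :+ q :* (m :* con 0ℚ)) refl (1ℚ + ρ * β) (1ℚ + ρ) M ⟩
      (1ℚ + ρ * β) + (1ℚ + ρ) * (M * 0ℚ) ∎
      where
      open ℚ.≤-Reasoning
      open +-*-Solver
      ∣S∪T∣≤ : ∣ S ∪ T ∣ ℕ.≤ k ℕ.+ k
      ∣S∪T∣≤ = ℕ.≤-trans (∣∪∣-≤ S T) (ℕ.≤-reflexive (cong₂ ℕ._+_ ∣S∣≡k ∣T∣≡k))
    ... | yes S⊆T = begin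
      (1ℚ + ρ * ι (#kSubsets ∣ S ∪ T ∣ k)) * (1ℚ + M * 1ℚ)
        ≡⟨ cong (λ n → (1ℚ + ρ * n) * (1ℚ + M * 1ℚ)) (trans (cong ι onlyT) ι1≡1) ⟩
      (1ℚ + ρ * 1ℚ) * (1ℚ + M * 1ℚ)
        ≡⟨ solve 2 (λ ρ m → (con 1ℚ :+ ρ :* con 1ℚ) :* (con 1ℚ :+ m :* con 1ℚ) :=
            (con 1ℚ :+ ρ :* con 1ℚ) :+ (con 1ℚ :+ ρ) :* (m :* con 1ℚ))
          refl ρ M ⟩
      (1ℚ + ρ * 1ℚ) + (1ℚ + ρ) * (M * 1ℚ)
        ≤⟨ ℚ.+-monoˡ-≤ ((1ℚ + ρ) * (M * 1ℚ))
          (ℚ.+-monoʳ-≤ 1ℚ (*-monoˡ ρ 0≤ρ (subst (_≤ β) ι1≡1 (ι-mono (ℕ.m^n>0 2 (k ℕ.+ k)))))) ⟩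
      (1ℚ + ρ * β) + (1ℚ + ρ) * (M * 1ℚ) ∎
      where
      open ℚ.≤-Reasoning
      open +-*-Solver
      onlyT : #kSubsets ∣ S ∪ T ∣ k ≡ 1
      onlyT = trans (cong (λ n → #kSubsets n k) (trans (cong ∣_∣ (⊆⇒∪≡ S⊆T)) ∣T∣≡k))
        (#kSubsets-self k)

    thirdMoment-≤ :
      𝔼 (D₀ G r) (λ X → likelihoodRatio X * (likelihoodRatio X * likelihoodRatio X)) ≤
      (1ℚ + ρ * β) + (1ℚ + ρ) * ρ
    thirdMoment-≤ = begin
      𝔼 (D₀ G r) (λ X → likelihoodRatio X * (likelihoodRatio X * likelihoodRatio X))
        ≡⟨ 𝔼-cong (D₀ G r) likelihoodRatio³ ⟩
      𝔼 (D₀ G r) (λ X → 𝔼 K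
        (λ T → 𝔼 K (λ S → 𝔼 K (λ V → weight V X * (weight S X * weight T X)))))
        ≡⟨ 𝔼-swap (D₀ G r) K
          (λ X T → 𝔼 K (λ S → 𝔼 K (λ V → weight V X * (weight S X * weight T X)))) ⟩
      𝔼 K (λ T → 𝔼 (D₀ G r)
        (λ X → 𝔼 K (λ S → 𝔼 K (λ V → weight V X * (weight S X * weight T X)))))
        ≡⟨ 𝔼-cong K (λ T → trans
             (𝔼-swap (D₀ G r) K (λ X S → 𝔼 K (λ V → weight V X * (weight S X * weight T X))))
             (𝔼-cong K (λ S → 𝔼-swap (D₀ G r) K
               (λ X V → weight V X * (weight S X * weight T X))))) ⟩
      𝔼 K (λ T → 𝔼 K
        (λ S → 𝔼 K (λ V → 𝔼 (D₀ G r) (λ X → weight V X * (weight S X * weight T X)))))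
        ≤⟨ 𝔼-mono-Always K size
          (λ T ∣T∣≡k → 𝔼-mono-Always K size (λ S ∣S∣≡k → pair S T ∣S∣≡k ∣T∣≡k)) ⟩
      𝔼 K (λ T → 𝔼 K (λ S → (1ℚ + ρ * β) + (1ℚ + ρ) * (M * 𝟙 (does (S ⊆? T)))))
        ≡⟨ 𝔼-cong-Always K size (λ T ∣T∣≡k → single T ∣T∣≡k) ⟩
      𝔼 K (λ T → (1ℚ + ρ * β) + (1ℚ + ρ) * ρ)
        ≡⟨ 𝔼-const K ((1ℚ + ρ * β) + (1ℚ + ρ) * ρ) ⟩
      (1ℚ + ρ * β) + (1ℚ + ρ) * ρ ∎
      where
      open ℚ.≤-Reasoning
      open +-*-Solver

      pair : ∀ S T → ∣ S ∣ ≡ k → ∣ T ∣ ≡ k →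
             𝔼 K (λ V → 𝔼 (D₀ G r) (λ X → weight V X * (weight S X * weight T X))) ≤
             (1ℚ + ρ * β) + (1ℚ + ρ) * (M * 𝟙 (does (S ⊆? T)))
      pair S T ∣S∣≡k ∣T∣≡k = begin
        𝔼 K (λ V → 𝔼 (D₀ G r) (λ X → weight V X * (weight S X * weight T X)))
          ≤⟨ 𝔼-mono K (λ V → 𝔼-weight₃-≤ S T V (nonempty ∣T∣≡k)) ⟩
        𝔼 K (λ V → correlation V (S ∪ T) * correlation S T)
          ≡⟨ 𝔼-*ʳ K (correlation S T) (λ V → correlation V (S ∪ T)) ⟩
        𝔼 K (λ V → correlation V (S ∪ T)) * correlation S T
          ≡⟨ cong (_* correlation S T) (𝔼-correlation (S ∪ T)) ⟩
        (1ℚ + ρ * ι (#kSubsets ∣ S ∪ T ∣ k)) * correlation S T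
          ≤⟨ correlation-≤ {S} {T} ∣S∣≡k ∣T∣≡k ⟩
        (1ℚ + ρ * β) + (1ℚ + ρ) * (M * 𝟙 (does (S ⊆? T))) ∎

      single : ∀ T → ∣ T ∣ ≡ k →
               𝔼 K (λ S → (1ℚ + ρ * β) + (1ℚ + ρ) * (M * 𝟙 (does (S ⊆? T)))) ≡
               (1ℚ + ρ * β) + (1ℚ + ρ) * ρ
      single T ∣T∣≡k = begin-equality
        𝔼 K (λ S → (1ℚ + ρ * β) + (1ℚ + ρ) * (M * 𝟙 (does (S ⊆? T))))
          -- Completes the indicator to a correlation, so that `𝔼-correlation` applies with `T` as
          -- the ambient set.
          ≡⟨ 𝔼-cong K
            (λ S → solve 3 (λ p q m → p :+ q :* m := (p :- q) :+ q :* (con 1ℚ :+ m)) refl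
               (1ℚ + ρ * β) (1ℚ + ρ) (M * 𝟙 (does (S ⊆? T)))) ⟩
        𝔼 K (λ S → ((1ℚ + ρ * β) - (1ℚ + ρ)) + (1ℚ + ρ) * correlation S T)
          ≡⟨ trans (𝔼-+ K (λ _ → (1ℚ + ρ * β) - (1ℚ + ρ)) (λ S → (1ℚ + ρ) * correlation S T))
            (cong₂ _+_ (𝔼-const K ((1ℚ + ρ * β) - (1ℚ + ρ)))
              (𝔼-*ˡ K (1ℚ + ρ) (λ S → correlation S T))) ⟩
        ((1ℚ + ρ * β) - (1ℚ + ρ)) + (1ℚ + ρ) * 𝔼 K (λ S → correlation S T)
          ≡⟨ cong (λ e → ((1ℚ + ρ * β) - (1ℚ + ρ)) + (1ℚ + ρ) * e) (trans (𝔼-correlation T)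
               (cong (λ n → 1ℚ + ρ * n)
                 (trans (cong ι (trans (cong (λ n → #kSubsets n k) ∣T∣≡k) (#kSubsets-self k)))
                   ι1≡1))) ⟩
        ((1ℚ + ρ * β) - (1ℚ + ρ)) + (1ℚ + ρ) * (1ℚ + ρ * 1ℚ)
          ≡⟨ solve 2 (λ p ρ → (p :- (con 1ℚ :+ ρ)) :+ (con 1ℚ :+ ρ) :* (con 1ℚ :+ ρ :* con 1ℚ) :=
              p :+ (con 1ℚ :+ ρ) :* ρ)
            refl (1ℚ + ρ * β) ρ ⟩
        (1ℚ + ρ * β) + (1ℚ + ρ) * ρ ∎

  -- Estimates for binomial coefficients and powers

  -- The absorption identity: both sides count (k+1)-subsets of an (r+1)-set with a marked element.
  -- It drives the induction in `r^k≤#kSubsets*k^k`.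
  #kSubsets-absorb : ∀ r k → suc k ℕ.* #kSubsets (suc r) (suc k) ≡ suc r ℕ.* #kSubsets r k
  #kSubsets-absorb zero    zero    = refl
  #kSubsets-absorb zero    (suc k) = trans
    (cong (suc (suc k) ℕ.*_) (#kSubsets-pascal 0 (suc k))) (ℕ.*-zeroʳ (suc (suc k)))
  #kSubsets-absorb (suc r) zero    = begin
    1 ℕ.* #kSubsets (suc (suc r)) 1       ≡⟨ ℕ.*-identityˡ _ ⟩
    #kSubsets (suc (suc r)) 1             ≡⟨ #kSubsets-pascal (suc r) 0 ⟩
    1 ℕ.+ #kSubsets (suc r) 1             ≡⟨ cong suc (ℕ.*-identityˡ _) ⟨
    1 ℕ.+ 1 ℕ.* #kSubsets (suc r) 1       ≡⟨ cong suc (#kSubsets-absorb r 0) ⟩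
    1 ℕ.+ suc r ℕ.* #kSubsets r 0         ≡⟨ cong (λ n → 1 ℕ.+ suc r ℕ.* n) (#kSubsets-0 r) ⟩
    suc (suc r) ℕ.* 1                     ∎
    where open ≡-Reasoning
  #kSubsets-absorb (suc r) (suc k) = begin
    suc (suc k) ℕ.* #kSubsets (suc (suc r)) (suc (suc k))
      ≡⟨ cong (suc (suc k) ℕ.*_) (#kSubsets-pascal (suc r) (suc k)) ⟩
    suc (suc k) ℕ.* (n₁ ℕ.+ n₂)
      -- One `n₁` is set aside so that the remaining multiples match the induction hypotheses for
      -- `k` and `suc k`.
      ≡⟨ solve 3 (λ k a b → (con 1 :+ (con 1 :+ k)) :* (a :+ b) :=
          a :+ ((con 1 :+ k) :* a :+ (con 1 :+ (con 1 :+ k)) :* b))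
        refl k n₁ n₂ ⟩
    n₁ ℕ.+ (suc k ℕ.* n₁ ℕ.+ suc (suc k) ℕ.* n₂)
      ≡⟨ cong₂ (λ a b → n₁ ℕ.+ (a ℕ.+ b)) (#kSubsets-absorb r k) (#kSubsets-absorb r (suc k)) ⟩
    n₁ ℕ.+ (suc r ℕ.* #kSubsets r k ℕ.+ suc r ℕ.* #kSubsets r (suc k))
      ≡⟨ cong (n₁ ℕ.+_) (ℕ.*-distribˡ-+ (suc r) (#kSubsets r k) (#kSubsets r (suc k))) ⟨
    n₁ ℕ.+ suc r ℕ.* (#kSubsets r k ℕ.+ #kSubsets r (suc k))
      ≡⟨ cong (λ n → n₁ ℕ.+ suc r ℕ.* n) (#kSubsets-pascal r k) ⟨
    suc (suc r) ℕ.* n₁ ∎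
    where
    open ≡-Reasoning
    open ℕ.+-*-Solver
    n₁ = #kSubsets (suc r) (suc k)
    n₂ = #kSubsets (suc r) (suc (suc k))

  ^-distribˡ-* : ∀ m n o → (m ℕ.* n) ℕ.^ o ≡ m ℕ.^ o ℕ.* n ℕ.^ o
  ^-distribˡ-* m n zero    = refl
  ^-distribˡ-* m n (suc o) = trans (cong (m ℕ.* n ℕ.*_) (^-distribˡ-* m n o))
    (ℕ.[m*n]*[o*p]≡[m*o]*[n*p] m n (m ℕ.^ o) (n ℕ.^ o))

  -- The classical bound (r/k)^k ≤ C(r, k), free of division. Absorption splits off the factor
  -- (r+1)/(k+1), and `rescale` adjusts the remaining ones.
  r^k≤#kSubsets*k^k : ∀ {r k} → k ℕ.≤ r → r ℕ.^ k ℕ.≤ #kSubsets r k ℕ.* k ℕ.^ k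
  r^k≤#kSubsets*k^k {r}     {zero}  _           =
    ℕ.≤-reflexive (sym (trans (ℕ.*-identityʳ (#kSubsets r 0)) (#kSubsets-0 r)))
  r^k≤#kSubsets*k^k {suc r} {suc k} (ℕ.s≤s k≤r) = begin
    suc r ℕ.* suc r ℕ.^ k
      ≤⟨ ℕ.*-monoʳ-≤ (suc r) (rescale k k≤r) ⟩
    suc r ℕ.* (#kSubsets r k ℕ.* suc k ℕ.^ k)
      ≡⟨ ℕ.*-assoc (suc r) (#kSubsets r k) (suc k ℕ.^ k) ⟨
    suc r ℕ.* #kSubsets r k ℕ.* suc k ℕ.^ k
      ≡⟨ cong (ℕ._* suc k ℕ.^ k) (#kSubsets-absorb r k) ⟨
    suc k ℕ.* #kSubsets (suc r) (suc k) ℕ.* suc k ℕ.^ k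
      ≡⟨ solve 3 (λ a b c → a :* b :* c := b :* (a :* c))
        refl (suc k) (#kSubsets (suc r) (suc k)) (suc k ℕ.^ k) ⟩
    #kSubsets (suc r) (suc k) ℕ.* suc k ℕ.^ suc k            ∎
    where
    open ℕ.≤-Reasoning
    open ℕ.+-*-Solver
    -- Since k ≤ r, the quotient (r+1)/(k+1) is at most r/k. Clearing the denominator kᵏ requires k
    -- ≠ 0.
    rescale : ∀ k → k ℕ.≤ r → suc r ℕ.^ k ℕ.≤ #kSubsets r k ℕ.* suc k ℕ.^ k
    rescale zero      _   = r^k≤#kSubsets*k^k {r} {0} ℕ.z≤n
    rescale k@(suc _) k≤r = ℕ.*-cancelʳ-≤ _ _ (k ℕ.^ k) {{ℕ.m^n≢0 k k}} (begin
      suc r ℕ.^ k ℕ.* k ℕ.^ k                          ≡⟨ ^-distribˡ-* (suc r) k k ⟨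
      (suc r ℕ.* k) ℕ.^ k
        ≤⟨ ℕ.^-monoˡ-≤ k (ℕ.+-mono-≤ k≤r (ℕ.≤-reflexive (ℕ.*-comm r k))) ⟩
      (suc k ℕ.* r) ℕ.^ k                              ≡⟨ ^-distribˡ-* (suc k) r k ⟩
      suc k ℕ.^ k ℕ.* r ℕ.^ k
        ≤⟨ ℕ.*-monoʳ-≤ (suc k ℕ.^ k) (r^k≤#kSubsets*k^k k≤r) ⟩
      suc k ℕ.^ k ℕ.* (#kSubsets r k ℕ.* k ℕ.^ k)
        ≡⟨ solve 3 (λ a b c → a :* (b :* c) := b :* a :* c)
          refl (suc k ℕ.^ k) (#kSubsets r k) (k ℕ.^ k) ⟩
      #kSubsets r k ℕ.* suc k ℕ.^ k ℕ.* k ℕ.^ k        ∎)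

  1≤ιk^k : ∀ k → 1ℚ ≤ ι (k ℕ.^ k)
  1≤ιk^k zero      = ℚ.≤-reflexive (sym ι1≡1)
  1≤ιk^k k@(suc _) = subst (_≤ ι (k ℕ.^ k)) ι1≡1 (ι-mono (ℕ.m^n>0 k k))

  -- From k = 4 on, 4ᵏ ≤ kᵏ. The factor 4 is for the small cases, with equality at k = 1 and k = 2.
  2^[k+k]≤4*k^k : ∀ k → 0 ℕ.< k → 2 ℕ.^ (k ℕ.+ k) ℕ.≤ 4 ℕ.* k ℕ.^ k
  2^[k+k]≤4*k^k 1 _ = ℕ.≤ᵇ⇒≤ _ _ _
  2^[k+k]≤4*k^k 2 _ = ℕ.≤ᵇ⇒≤ _ _ _
  2^[k+k]≤4*k^k 3 _ = ℕ.≤ᵇ⇒≤ _ _ _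
  2^[k+k]≤4*k^k k@(suc (suc (suc (suc _)))) _ = begin
    2 ℕ.^ (k ℕ.+ k)   ≡⟨ cong (λ n → 2 ℕ.^ (k ℕ.+ n)) (ℕ.+-identityʳ k) ⟨
    2 ℕ.^ (2 ℕ.* k)   ≡⟨ ℕ.^-*-assoc 2 2 k ⟨
    4 ℕ.^ k           ≤⟨ ℕ.^-monoˡ-≤ k (ℕ.m≤m+n 4 _) ⟩
    k ℕ.^ k           ≤⟨ ℕ.m≤n*m (k ℕ.^ k) 4 ⟩
    4 ℕ.* k ℕ.^ k     ∎
    where open ℕ.≤-Reasoning

  -- Inequalities of Young and Hölder

  0≤square : ∀ p → 0ℚ ≤ p * p
  0≤square p with ℚ.≤-total 0ℚ p
  ... | inj₁ 0≤p = 0≤* 0≤p 0≤p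
  ... | inj₂ p≤0 = subst (0ℚ ≤_) (solve 1 (λ p → (:- p) :* (:- p) := p :* p) refl p)
    (0≤* (ℚ.neg-antimono-≤ p≤0) (ℚ.neg-antimono-≤ p≤0))
    where open +-*-Solver

  0≤q-p⇒p≤q : ∀ {p q} → 0ℚ ≤ q - p → p ≤ q
  0≤q-p⇒p≤q {p} {q} h = subst₂ _≤_ (ℚ.+-identityˡ p) (restore q p) (ℚ.+-monoˡ-≤ p h)

  p≤q⇒0≤q-p : ∀ {p q} → p ≤ q → 0ℚ ≤ q - p
  p≤q⇒0≤q-p {p} {q} h = subst (_≤ q - p) (ℚ.+-inverseʳ p) (ℚ.+-monoˡ-≤ (- p) h)

  -- The difference of the two sides is (x - y)²(x + 2y).
  cube-young : ∀ x y → 0ℚ ≤ x → 0ℚ ≤ y → ι 3 * (x * (y * y)) ≤ x * (x * x) + ι 2 * (y * (y * y))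
  cube-young x y 0≤x 0≤y = 0≤q-p⇒p≤q (subst (0ℚ ≤_) factor
    (0≤* (0≤square (x - y)) (0≤+ 0≤x (0≤+ 0≤y 0≤y))))
    where
    open +-*-Solver
    factor : (x - y) * (x - y) * (x + (y + y)) ≡
             (x * (x * x) + ι 2 * (y * (y * y))) - ι 3 * (x * (y * y))
    factor = trans
      (solve 2 (λ x y → (x :- y) :* (x :- y) :* (x :+ (y :+ y)) :=
         (x :* (x :* x) :+ con (+ 2 / 1) :* (y :* (y :* y))) :-
         con (+ 3 / 1) :* (x :* (y :* y))) refl x y)
      (sym (cong₂ (λ a b → (x * (x * x) + a * (y * (y * y))) - b * (x * (y * y))) (ι≡/1 2)
        (ι≡/1 3)))

  -- Hölder's inequality for the exponents 3 and 3/2, cubed so that no roots occur.  It is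
  -- Young's inequality for p L(x) and q, averaged with the weights s(x).
  𝔼-hölder : ∀ {a} {A : Set a} (D : Rand A) (L s : A → ℚ) →
             (∀ x → 0ℚ ≤ L x) → (∀ x → 0ℚ ≤ s x) → (∀ x → s x ≤ 1ℚ) →
             let q = 𝔼 D (λ x → L x * s x) in
             ∀ {p} → 0ℚ < p → 𝔼 D s ≤ p →
             q * (q * q) ≤ 𝔼 D (λ x → L x * (L x * L x)) * (p * p)
  𝔼-hölder D L s 0≤L 0≤s s≤1 {p} 0<p 𝔼s≤p =
    -- Averaging gives 3pq³ ≤ p³𝔼[L³] + 2pq³. After subtraction a factor `p` is left on both sides,
    -- and its positivity spares a case distinction on 𝔼[s] = 0.
    ℚ.*-cancelˡ-≤-pos p {{ℚ.positive 0<p}}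
      (0≤q-p⇒p≤q (subst (0ℚ ≤_) rearrange (p≤q⇒0≤q-p averaged)))
    where
    open +-*-Solver
    open ℚ.≤-Reasoning
    q = 𝔼 D (λ x → L x * s x)
    A₃ = 𝔼 D (λ x → L x * (L x * L x))
    p³ = p * (p * p)
    q³ = q * (q * q)
    0≤p = ℚ.<⇒≤ 0<p
    0≤q : 0ℚ ≤ q
    0≤q = 𝔼-≥0 D (λ x → 0≤* (0≤L x) (0≤s x))
    0≤q³ = 0≤* 0≤q (0≤* 0≤q 0≤q)
    0≤p³ = 0≤* 0≤p (0≤* 0≤p 0≤p)

    pointwise : ∀ x →
      (ι 3 * (p * (q * q))) * (L x * s x) ≤ p³ * (L x * (L x * L x)) + (ι 2 * q³) * s x
    pointwise x = begin
      (ι 3 * (p * (q * q))) * (L x * s x)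
        ≡⟨ solve 5 (λ t p q l s → (t :* (p :* (q :* q))) :* (l :* s) :=
            (t :* ((p :* l) :* (q :* q))) :* s)
          refl (ι 3) p q (L x) (s x) ⟩
      (ι 3 * ((p * L x) * (q * q))) * s x
        ≤⟨ *-monoʳ (s x) (0≤s x) (cube-young (p * L x) q (0≤* 0≤p (0≤L x)) 0≤q) ⟩
      ((p * L x) * ((p * L x) * (p * L x)) + ι 2 * q³) * s x
        ≡⟨ solve 4 (λ c p l s → ((p :* l) :* ((p :* l) :* (p :* l)) :+ c) :* s :=
            (p :* (p :* p)) :* (l :* (l :* l)) :* s :+ c :* s)
          refl (ι 2 * q³) p (L x) (s x) ⟩
      p³ * (L x * (L x * L x)) * s x + (ι 2 * q³) * s x
        -- The weight `s x` is dropped from the cubic term alone; in the other term its mean is to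
        -- be bounded by `p`.
        ≤⟨ ℚ.+-monoˡ-≤ ((ι 2 * q³) * s x)
          (*-monoˡ (p³ * (L x * (L x * L x))) (0≤* 0≤p³ (0≤* (0≤L x) (0≤* (0≤L x) (0≤L x))))
            (s≤1 x)) ⟩
      p³ * (L x * (L x * L x)) * 1ℚ + (ι 2 * q³) * s x
        ≡⟨ cong (λ z → z + (ι 2 * q³) * s x) (ℚ.*-identityʳ (p³ * (L x * (L x * L x)))) ⟩
      p³ * (L x * (L x * L x)) + (ι 2 * q³) * s x ∎

    averaged : (ι 3 * (p * (q * q))) * q ≤ p³ * A₃ + (ι 2 * q³) * p
    averaged = begin
      (ι 3 * (p * (q * q))) * q
        ≡⟨ 𝔼-*ˡ D (ι 3 * (p * (q * q))) (λ x → L x * s x) ⟨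
      𝔼 D (λ x → (ι 3 * (p * (q * q))) * (L x * s x))
        ≤⟨ 𝔼-mono D pointwise ⟩
      𝔼 D (λ x → p³ * (L x * (L x * L x)) + (ι 2 * q³) * s x)
        ≡⟨ trans (𝔼-+ D (λ x → p³ * (L x * (L x * L x))) (λ x → (ι 2 * q³) * s x))
                 (cong₂ _+_ (𝔼-*ˡ D p³ (λ x → L x * (L x * L x))) (𝔼-*ˡ D (ι 2 * q³) s)) ⟩
      p³ * A₃ + (ι 2 * q³) * 𝔼 D s
        ≤⟨ ℚ.+-monoʳ-≤ (p³ * A₃) (*-monoˡ (ι 2 * q³) (0≤* (0≤ι 2) 0≤q³) 𝔼s≤p) ⟩
      p³ * A₃ + (ι 2 * q³) * p ∎

    rearrange : (p³ * A₃ + (ι 2 * q³) * p) - (ι 3 * (p * (q * q))) * q ≡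
      p * (A₃ * (p * p)) - p * (q * (q * q))
    rearrange = trans
      (cong (λ t → (p³ * A₃ + (ι 2 * q³) * p) - (t * (p * (q * q))) * q) (ι-suc 2))
      (solve 4 (λ t p q a →
        ((p :* (p :* p)) :* a :+ (t :* (q :* (q :* q))) :* p) :-
          ((con 1ℚ :+ t) :* (p :* (q :* q))) :* q
         := p :* (a :* (p :* p)) :- p :* (q :* (q :* q))) refl (ι 2) p q A₃)

  -- The third moment in terms of k

  module _ {c ℓ} (G : FiniteAbelianGroup c ℓ) {k r : ℕ} (k≤r : k ℕ.≤ r) (0<k : 0 ℕ.< k)
           (∣G∣≤4r^k : FiniteAbelianGroup.order G ℕ.≤ 4 ℕ.* r ℕ.^ k) where

    open FiniteAbelianGroup G using (Carrier)
    open Planting G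
    open ThirdMoment G k≤r 0<k

    private
      κ = ι (k ℕ.^ k)
      N = #kSubsets r k

      0≤κ : 0ℚ ≤ κ
      0≤κ = 0≤ι (k ℕ.^ k)

      1≤κ : 1ℚ ≤ κ
      1≤κ = 1≤ιk^k k

      β≤4κ : β ≤ ι 4 * κ
      β≤4κ = ℚ.≤-trans (ι-mono (2^[k+k]≤4*k^k k 0<k)) (ℚ.≤-reflexive (ι-* 4 (k ℕ.^ k)))

      ρ≤4κ : ρ ≤ ι 4 * κ
      ρ≤4κ = begin
        M * ((+ 1) / N)
          ≤⟨ *-monoʳ ((+ 1) / N) (0≤1/ N)
            (ι-mono (ℕ.≤-trans ∣G∣≤4r^k (ℕ.*-monoʳ-≤ 4 (r^k≤#kSubsets*k^k k≤r)))) ⟩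
        ι (4 ℕ.* (N ℕ.* k ℕ.^ k)) * ((+ 1) / N)
          ≡⟨ cong (_* ((+ 1) / N)) (trans (ι-* 4 _) (cong (ι 4 *_) (ι-* N (k ℕ.^ k)))) ⟩
        ι 4 * (ι N * κ) * ((+ 1) / N)
          ≡⟨ solve 4 (λ f n c u → f :* (n :* c) :* u := (f :* c) :* (n :* u))
            refl (ι 4) (ι N) κ ((+ 1) / N) ⟩
        (ι 4 * κ) * (ι N * ((+ 1) / N))       ≡⟨ cong ((ι 4 * κ) *_) (ι*1/ N) ⟩
        (ι 4 * κ) * 1ℚ                        ≡⟨ ℚ.*-identityʳ (ι 4 * κ) ⟩
        ι 4 * κ                               ∎
        where
        open ℚ.≤-Reasoning
        open +-*-Solver

    -- With ρ and β at most 4κ and 1 ≤ κ, the three contributions are κ², 16κ² and 5κ · 4κ.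
    thirdMoment-≤-37κ² :
      𝔼 (D₀ G r) (λ X → likelihoodRatio X * (likelihoodRatio X * likelihoodRatio X)) ≤
      ι 37 * (ι (k ℕ.^ k) * ι (k ℕ.^ k))
    thirdMoment-≤-37κ² = begin
      𝔼 (D₀ G r) (λ X → likelihoodRatio X * (likelihoodRatio X * likelihoodRatio X))
        ≤⟨ thirdMoment-≤ ⟩
      (1ℚ + ρ * β) + (1ℚ + ρ) * ρ
        ≤⟨ ℚ.+-mono-≤ (ℚ.+-monoʳ-≤ 1ℚ (*-mono-≤ 0≤ρ 0≤4κ ρ≤4κ β≤4κ))
             (*-mono-≤ (0≤+ 0≤1 0≤ρ) 0≤4κ (ℚ.+-monoʳ-≤ 1ℚ ρ≤4κ) ρ≤4κ) ⟩
      (1ℚ + (ι 4 * κ) * (ι 4 * κ)) + (1ℚ + ι 4 * κ) * (ι 4 * κ)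
        ≤⟨ ℚ.+-mono-≤ (ℚ.+-monoˡ-≤ ((ι 4 * κ) * (ι 4 * κ)) 1≤κ²)
          (*-monoʳ (ι 4 * κ) 0≤4κ (ℚ.+-monoˡ-≤ (ι 4 * κ) 1≤κ)) ⟩
      (κ * κ + (ι 4 * κ) * (ι 4 * κ)) + (κ + ι 4 * κ) * (ι 4 * κ)
        ≡⟨ cong (λ f → (κ * κ + (f * κ) * (f * κ)) + (κ + f * κ) * (f * κ)) (ι≡/1 4) ⟩
      (κ * κ + (f * κ) * (f * κ)) + (κ + f * κ) * (f * κ)
        ≡⟨ solve 1 (λ κ → (κ :* κ :+ (con f :* κ) :* (con f :* κ)) :+
                           (κ :+ con f :* κ) :* (con f :* κ) := con (+ 37 / 1) :* (κ :* κ))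
          refl κ ⟩
      (+ 37 / 1) * (κ * κ)
        ≡⟨ cong (λ t → t * (κ * κ)) (ι≡/1 37) ⟨
      ι 37 * (κ * κ) ∎
      where
      open ℚ.≤-Reasoning
      open +-*-Solver
      f = + 4 / 1
      0≤4κ : 0ℚ ≤ ι 4 * κ
      0≤4κ = 0≤* (0≤ι 4) 0≤κ
      1≤κ² : 1ℚ ≤ κ * κ
      1≤κ² = *-mono-≤ {1ℚ} {κ} {1ℚ} {κ} 0≤1 0≤κ 1≤κ 1≤κ

    planted³-≤ : (s : Vec Carrier r → ℚ) → Respects s →
                 (∀ X → 0ℚ ≤ s X) → (∀ X → s X ≤ 1ℚ) →
                 let q = 𝔼 (D₁ G k r k≤r) s in
                 ∀ {p} → 0ℚ < p → 𝔼 (D₀ G r) s ≤ p →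
                 q * (q * q) ≤ ι 37 * (ι (k ℕ.^ k) * ι (k ℕ.^ k)) * (p * p)
    planted³-≤ s s-cong 0≤s s≤1 {p} 0<p 𝔼s≤p = begin
      q * (q * q)
        ≡⟨ cong (λ q → q * (q * q)) (𝔼-D₁ s s-cong) ⟩
      q′ * (q′ * q′)
        ≤⟨ 𝔼-hölder (D₀ G r) likelihoodRatio s 0≤likelihoodRatio 0≤s s≤1 0<p 𝔼s≤p ⟩
      𝔼 (D₀ G r) (λ X → likelihoodRatio X * (likelihoodRatio X * likelihoodRatio X)) * (p * p)
        ≤⟨ *-monoʳ (p * p) (0≤square p) thirdMoment-≤-37κ² ⟩
      ι 37 * (κ * κ) * (p * p) ∎
      where
      open ℚ.≤-Reasoning
      q = 𝔼 (D₁ G k r k≤r) s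
      q′ = 𝔼 (D₀ G r) (λ X → likelihoodRatio X * s X)

  -- The group order at density 1

  ι-cancel-≤ : ∀ {m n} → ι m ≤ ι n → m ℕ.≤ n
  ι-cancel-≤ {m} {n} ιm≤ιn with m ℕ.≤? n
  ... | yes m≤n = m≤n
  ... | no  m≰n = contradiction
    (ℚ.≤-<-trans (ℚ.≤-trans (ι-mono (ℕ.≰⇒> m≰n)) ιm≤ιn)
      (subst₂ _<_ (ℚ.+-identityˡ (ι n)) (sym (ι-suc n)) (ℚ.+-monoˡ-< (ι n) (ℚ.positive⁻¹ 1ℚ))))
    (ℚ.<-irrefl refl)

  -- `x`, `ℓ` and `D` stand for approximants of k log r, log |G| and Δ. For D = 1 and no error, ∣x/ℓ
  -- - 1∣ ≤ 1/ℓ gives ℓ ≤ x + 1; the errors raise the 1 to at most 1/8 + (9/8)² = 89/64.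
  ℓ≤x+3/2 : ∀ {x ℓ D η} → 0ℚ < η → 1ℚ ≤ ℓ → η * ℓ ≤ (+ 1) / 8 → 1ℚ ≤ η + D → D ≤ η + 1ℚ →
            ℚ.∣ x * invℚ ℓ - D ∣ * invℚ D ≤ η + 1ℚ * invℚ ℓ → ℓ ≤ x + (+ 3) / 2
  ℓ≤x+3/2 {x} {ℓ} {D} {η} 0<η 1≤ℓ ηℓ≤⅛ 1≤η+D D≤η+1 h = begin
    ℓ                                          ≡⟨ ℚ.*-identityˡ ℓ ⟨
    1ℚ * ℓ                                     ≤⟨ *-monoʳ ℓ 0≤ℓ 1≤η+D ⟩
    (η + D) * ℓ                                ≡⟨ ℚ.*-distribʳ-+ ℓ η D ⟩
    η * ℓ + D * ℓ                              ≤⟨ ℚ.+-monoʳ-≤ (η * ℓ) Dℓ≤ ⟩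
    η * ℓ + (x + (η * ℓ + 1ℚ) * D)             ≤⟨ ℚ.+-mono-≤ ηℓ≤⅛ (ℚ.+-monoʳ-≤ x
                                                    (*-mono-≤ 0≤ηℓ+1 0≤9/8 (ℚ.+-monoˡ-≤ 1ℚ ηℓ≤⅛)
                                                      (ℚ.≤-trans D≤η+1 (ℚ.+-monoˡ-≤ 1ℚ η≤⅛)))) ⟩
    ⅛ + (x + (⅛ + 1ℚ) * (⅛ + 1ℚ))
      ≡⟨ solve 1 (λ x → con ⅛ :+ (x :+ con ((⅛ + 1ℚ) * (⅛ + 1ℚ))) :=
          x :+ con (⅛ + (⅛ + 1ℚ) * (⅛ + 1ℚ)))
        refl x ⟩
    x + (⅛ + (⅛ + 1ℚ) * (⅛ + 1ℚ))
      ≤⟨ ℚ.+-monoʳ-≤ x (toWitness {a? = (⅛ + (⅛ + 1ℚ) * (⅛ + 1ℚ)) ℚ.≤? ((+ 3) / 2)} _) ⟩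
    x + (+ 3) / 2                              ∎
    where
    open ℚ.≤-Reasoning
    open +-*-Solver
    ⅛ = (+ 1) / 8
    0≤9/8 : 0ℚ ≤ ⅛ + 1ℚ
    0≤9/8 = toWitness {a? = 0ℚ ℚ.≤? (⅛ + 1ℚ)} _
    0<ℓ = ℚ.<-≤-trans (ℚ.positive⁻¹ 1ℚ) 1≤ℓ
    0≤ℓ = ℚ.<⇒≤ 0<ℓ
    η≤⅛ : η ≤ ⅛
    η≤⅛ = ℚ.≤-trans (subst (_≤ η * ℓ) (ℚ.*-identityʳ η) (*-monoˡ η (ℚ.<⇒≤ 0<η) 1≤ℓ)) ηℓ≤⅛
    0≤ηℓ+1 : 0ℚ ≤ η * ℓ + 1ℚ
    0≤ηℓ+1 = 0≤+ (0≤* (ℚ.<⇒≤ 0<η) 0≤ℓ) 0≤1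
    -- `invℚ` sends 0 to 0, so the rate says nothing about `D` until `D` is known to be nonzero.
    0<D : 0ℚ < D
    0<D = ℚ.<-≤-trans (toWitness {a? = 0ℚ ℚ.<? (1ℚ - ⅛)} _)
      (x≤z+y⇒x-y≤z
        (ℚ.≤-trans 1≤η+D (ℚ.≤-trans (ℚ.+-monoˡ-≤ D η≤⅛) (ℚ.≤-reflexive (ℚ.+-comm ⅛ D)))))
    i = invℚ ℓ
    ∣xi-D∣ = ℚ.∣ x * i - D ∣
    D≤ : D ≤ (η + 1ℚ * i) * D + x * i
    D≤ = x-y≤z⇒x≤z+y (begin
      D - x * i                    ≤⟨ p≤∣p∣ (D - x * i) ⟩
      ℚ.∣ D - x * i ∣              ≡⟨ ∣p-q∣≡∣q-p∣ D (x * i) ⟩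
      ∣xi-D∣                       ≡⟨ ℚ.*-identityʳ ∣xi-D∣ ⟨
      ∣xi-D∣ * 1ℚ                  ≡⟨ cong (∣xi-D∣ *_) (*-invℚ D 0<D) ⟨
      ∣xi-D∣ * (D * invℚ D)
        ≡⟨ solve 3 (λ a d i → a :* (d :* i) := a :* i :* d) refl ∣xi-D∣ D (invℚ D) ⟩
      ∣xi-D∣ * invℚ D * D          ≤⟨ *-monoʳ D (ℚ.<⇒≤ 0<D) h ⟩
      (η + 1ℚ * i) * D             ∎)
    Dℓ≤ : D * ℓ ≤ x + (η * ℓ + 1ℚ) * D
    Dℓ≤ = begin
      D * ℓ                                        ≤⟨ *-monoʳ ℓ 0≤ℓ D≤ ⟩
      ((η + 1ℚ * i) * D + x * i) * ℓ
        ≡⟨ solve 5 (λ η i d x l → ((η :+ con 1ℚ :* i) :* d :+ x :* i) :* l :=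
            x :* (l :* i) :+ (η :* l :+ (l :* i)) :* d)
          refl η i D x ℓ ⟩
      x * (ℓ * i) + (η * ℓ + (ℓ * i)) * D
        ≡⟨ cong (λ z → x * z + (η * ℓ + z) * D) (*-invℚ ℓ 0<ℓ) ⟩
      x * 1ℚ + (η * ℓ + 1ℚ) * D
        ≡⟨ cong (λ z → z + (η * ℓ + 1ℚ) * D) (ℚ.*-identityʳ x) ⟩
      x + (η * ℓ + 1ℚ) * D                         ∎

  -- The gap between 3/2 and 2 is worth half of `suc n`, which pays for `suc b` in place of `b` once
  -- `suc n` is at least 2. The successor is needed because a floor of a logarithm bounds a number
  -- from above only through the next power of 2.
  fromLogs : ∀ {k a b n} → ((+ b) / suc n) ≤ ((+ k) / 1) * ((+ a) / suc n) + (+ 3) / 2 →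
             2 ℕ.≤ suc n → suc b ℕ.≤ k ℕ.* a ℕ.+ 2 ℕ.* suc n
  fromLogs {k} {a} {b} {n} h 2≤s = ℕ.*-cancelˡ-≤ 2 (begin
    2 ℕ.* suc b                                        ≡⟨ ℕ.*-suc 2 b ⟩
    2 ℕ.+ 2 ℕ.* b                                      ≤⟨ ℕ.+-mono-≤ 2≤s 2b≤ ⟩
    s ℕ.+ (2 ℕ.* (k ℕ.* a) ℕ.+ 3 ℕ.* s)
      ≡⟨ solve 2 (λ s x → s :+ (con 2 :* x :+ con 3 :* s) := con 2 :* (x :+ con 2 :* s))
        refl s (k ℕ.* a) ⟩
    2 ℕ.* (k ℕ.* a ℕ.+ 2 ℕ.* s)                        ∎)
    where
    open ℕ.≤-Reasoning
    open ℕ.+-*-Solver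
    s = suc n
    u = (+ 1) / s
    ιs*u≡1 = ι*1/ s

    2b≤ : 2 ℕ.* b ℕ.≤ 2 ℕ.* (k ℕ.* a) ℕ.+ 3 ℕ.* s
    2b≤ = ι-cancel-≤ (subst₂ _≤_ lhs rhs (*-monoˡ (ι 2 * ι s) (0≤* (0≤ι 2) (0≤ι s)) h))
      where
      module S = +-*-Solver
      open S using () renaming (_:*_ to _⊛_; _:+_ to _⊞_; _:=_ to _≐_)
      lhs : ι 2 * ι s * ((+ b) / s) ≡ ι (2 ℕ.* b)
      lhs = trans (cong (ι 2 * ι s *_) (/≡ι*1/ b s))
        (trans (S.solve 4 (λ t s b u → t ⊛ s ⊛ (b ⊛ u) ≐ t ⊛ b ⊛ (s ⊛ u))
          refl (ι 2) (ι s) (ι b) u)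
        (trans (cong (ι 2 * ι b *_) ιs*u≡1) (trans (ℚ.*-identityʳ (ι 2 * ι b)) (sym (ι-* 2 b)))))
      rhs : ι 2 * ι s * (((+ k) / 1) * ((+ a) / s) + (+ 3) / 2) ≡ ι (2 ℕ.* (k ℕ.* a) ℕ.+ 3 ℕ.* s)
      rhs = trans
        (cong₂ (λ p q → ι 2 * ι s * (p + q)) (cong₂ _*_ (sym (ι≡/1 k)) (/≡ι*1/ a s)) (/≡ι*1/ 3 2))
        (trans (S.solve 7
          (λ t s k a u th v → t ⊛ s ⊛ (k ⊛ (a ⊛ u) ⊞ th ⊛ v) ≐
            t ⊛ (k ⊛ a) ⊛ (s ⊛ u) ⊞ th ⊛ s ⊛ (t ⊛ v)) refl
                 (ι 2) (ι s) (ι k) (ι a) u (ι 3) ((+ 1) / 2))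
        (trans (cong₂ (λ p q → ι 2 * (ι k * ι a) * p + ι 3 * ι s * q) ιs*u≡1 (ι*1/ 2))
        (trans (cong₂ _+_ (ℚ.*-identityʳ (ι 2 * (ι k * ι a))) (ℚ.*-identityʳ (ι 3 * ι s)))
        (sym (trans (ι-+ (2 ℕ.* (k ℕ.* a)) (3 ℕ.* s))
          (cong₂ _+_ (trans (ι-* 2 (k ℕ.* a)) (cong (ι 2 *_) (ι-* k a))) (ι-* 3 s)))))))

  -- The integer form of log M ≤ k log r + 2: both sides are compared as `s`-th powers, and strict
  -- monotonicity of the power cancels `s`.
  fromPowers : ∀ {M r k s} .{{_ : NonZero r}} .{{_ : NonZero s}} →
               suc ⌊log₂ M ℕ.^ s ⌋ ℕ.≤ k ℕ.* ⌊log₂ r ℕ.^ s ⌋ ℕ.+ 2 ℕ.* s → M ℕ.≤ 4 ℕ.* r ℕ.^ k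
  fromPowers {M} {r} {k} {s} h with M ℕ.≤? 4 ℕ.* r ℕ.^ k
  ... | yes M≤ = M≤
  ... | no  M≰ = contradiction (ℕ.<-trans (ℕ.^-monoˡ-< s (ℕ.≰⇒> M≰)) Mˢ<) (ℕ.<-irrefl refl)
    where
    open ℕ.≤-Reasoning
    l = ⌊log₂ r ℕ.^ s ⌋
    Mˢ< : M ℕ.^ s ℕ.< (4 ℕ.* r ℕ.^ k) ℕ.^ s
    Mˢ< = begin-strict
      M ℕ.^ s                              <⟨ n<2^[1+⌊log₂n⌋] (M ℕ.^ s) ⟩
      2 ℕ.^ suc ⌊log₂ M ℕ.^ s ⌋            ≤⟨ ℕ.^-monoʳ-≤ 2 h ⟩
      2 ℕ.^ (k ℕ.* l ℕ.+ 2 ℕ.* s)          ≡⟨ ℕ.^-distribˡ-+-* 2 (k ℕ.* l) (2 ℕ.* s) ⟩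
      2 ℕ.^ (k ℕ.* l) ℕ.* 2 ℕ.^ (2 ℕ.* s)
        ≡⟨ cong₂ ℕ._*_ (trans (cong (2 ℕ.^_) (ℕ.*-comm k l)) (sym (ℕ.^-*-assoc 2 l k)))
          (sym (ℕ.^-*-assoc 2 2 s)) ⟩
      (2 ℕ.^ l) ℕ.^ k ℕ.* 4 ℕ.^ s
        ≤⟨ ℕ.*-monoˡ-≤ (4 ℕ.^ s) (ℕ.^-monoˡ-≤ k (2^⌊log₂n⌋≤n (r ℕ.^ s) {{ℕ.m^n≢0 r s}})) ⟩
      (r ℕ.^ s) ℕ.^ k ℕ.* 4 ℕ.^ s
        ≡⟨ cong (ℕ._* 4 ℕ.^ s)
          (trans (ℕ.^-*-assoc r s k)
            (trans (cong (r ℕ.^_) (ℕ.*-comm s k)) (sym (ℕ.^-*-assoc r k s)))) ⟩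
      (r ℕ.^ k) ℕ.^ s ℕ.* 4 ℕ.^ s          ≡⟨ ℕ.*-comm ((r ℕ.^ k) ℕ.^ s) (4 ℕ.^ s) ⟩
      4 ℕ.^ s ℕ.* (r ℕ.^ k) ℕ.^ s          ≡⟨ ^-distribˡ-* 4 (r ℕ.^ k) s ⟨
      (4 ℕ.* r ℕ.^ k) ℕ.^ s                ∎

  -- For B ≥ log |G| and n large, the n-th approximants of the logarithms satisfy
  -- log |G| ≤ k log r + 3/2 as soon as those of Δ and of the rate are within η = 1/(8B); a
  -- further 1/2 covers the rounding, which gives |G| ≤ 2² rᵏ.
  order-≤ : ∀ {c ℓ} (k : ℕ) (E : GroupEnsemble c ℓ) (adm : Admissible k E) →
            Admissible.Δ adm ≃ℝ 1ℝ →
            ∀ r .{{_ : NonZero r}} → GroupEnsemble.order E r ℕ.≤ 4 ℕ.* r ℕ.^ k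
  order-≤ k E adm (Δ≤1 , 1≤Δ) r =
    let (B , 0<B , N₁ , ℓ≤B) = eventualBound (log∣G∣ r)
        0<8B = pos*pos (ℚ.positive⁻¹ ((+ 8) / 1)) 0<B
        η = invℚ (((+ 8) / 1) * B)
        0<η = 0<invℚ (((+ 8) / 1) * B) 0<8B
        (N₂ , Δ≤) = Δ≤1 η 0<η
        (N₃ , ≤Δ) = 1≤Δ η 0<η
        (N₄ , rateη) = rate r η 0<η
        -- A successor, so that the exponent `suc n` is at least 2, as `fromLogs` demands.
        n = suc ((N₁ ℕ.⊔ N₂) ℕ.⊔ (N₃ ℕ.⊔ N₄))
        (_ , _ , _ , 1≤log) = 0<log∣G∣ r (nontrivial r)
        1≤ℓ = subst (_≤ ℝ.seq (log∣G∣ r) n) (ℚ.+-identityʳ 1ℚ) (1≤log n ℕ.z≤n)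
        N₁≤n = ℕ.m≤n⇒m≤1+n (ℕ.≤-trans (ℕ.m≤m⊔n N₁ N₂) (ℕ.m≤m⊔n (N₁ ℕ.⊔ N₂) (N₃ ℕ.⊔ N₄)))
        N₂≤n = ℕ.m≤n⇒m≤1+n (ℕ.≤-trans (ℕ.m≤n⊔m N₁ N₂) (ℕ.m≤m⊔n (N₁ ℕ.⊔ N₂) (N₃ ℕ.⊔ N₄)))
        N₃≤n = ℕ.m≤n⇒m≤1+n (ℕ.≤-trans (ℕ.m≤m⊔n N₃ N₄) (ℕ.m≤n⊔m (N₁ ℕ.⊔ N₂) (N₃ ℕ.⊔ N₄)))
        N₄≤n = ℕ.m≤n⇒m≤1+n (ℕ.≤-trans (ℕ.m≤n⊔m N₃ N₄) (ℕ.m≤n⊔m (N₁ ℕ.⊔ N₂) (N₃ ℕ.⊔ N₄)))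
    in fromPowers {order r} {r} {k} {suc n}
      (fromLogs {k} {⌊log₂ r ℕ.^ suc n ⌋} {⌊log₂ order r ℕ.^ suc n ⌋} {n}
         (ℓ≤x+3/2 {ℝ.seq (fromℕ k *ℝ log₂ r) n} {ℝ.seq (log∣G∣ r) n} {ℝ.seq Δ n} {η}
           0<η 1≤ℓ (ηℓ≤⅛ 0<B (ℚ.≤-trans (p≤∣p∣ (ℝ.seq (log∣G∣ r) n)) (ℓ≤B n N₁≤n))) (≤Δ n N₃≤n)
             (Δ≤ n N₂≤n) (rateη n N₄≤n))
         (ℕ.s≤s (ℕ.s≤s ℕ.z≤n)))
    where
    open GroupEnsemble E
    open Admissible adm
    open +-*-Solver
    ηℓ≤⅛ : ∀ {B ℓ} → 0ℚ < B → ℓ ≤ B → invℚ (((+ 8) / 1) * B) * ℓ ≤ (+ 1) / 8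
    ηℓ≤⅛ {B} {ℓ} 0<B ℓ≤B = ℚ.*-cancelˡ-≤-pos ((+ 8) / 1) (subst₂ _≤_ refl
      (trans (solve 3 (λ e b i → e :* (i :* b) := (e :* b) :* i)
        refl ((+ 8) / 1) B η) (*-invℚ (((+ 8) / 1) * B) 0<8B))
      (*-monoˡ ((+ 8) / 1) (ℚ.nonNegative⁻¹ _) (*-monoˡ η (ℚ.<⇒≤ (0<invℚ _ 0<8B)) ℓ≤B)))
      where
      η = invℚ (((+ 8) / 1) * B)
      0<8B = pos*pos (ℚ.positive⁻¹ ((+ 8) / 1)) 0<B

  -- Success probabilities as expectations

  module _ {c ℓ} (G : FiniteAbelianGroup c ℓ) where

    plant-∅ : ∀ {r} (X : Vec (FiniteAbelianGroup.Carrier G) r) → plant G ∅ X ≡ X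
    plant-∅ []      = refl
    plant-∅ (x ∷ X) = cong (x ∷_) (plant-∅ X)

    -- For k = 0 the only choice is the empty set, to which `𝔼-plant` does not apply; planting it
    -- changes nothing, so the two distributions agree.
    𝔼-D₁-0 : ∀ r (0≤r : 0 ℕ.≤ r) (f : Vec (FiniteAbelianGroup.Carrier G) r → ℚ) →
      𝔼 (D₁ G 0 r 0≤r) f ≡ 𝔼 (D₀ G r) f
    𝔼-D₁-0 r ℕ.z≤n f = trans (𝔼->>= (D₀ G r) _ f) (𝔼-cong (D₀ G r) (onlyEmpty r f))
      where
      single : ∀ p → (p + 0ℚ) * 1ℚ ≡ p
      single p = trans (ℚ.*-identityʳ (p + 0ℚ)) (ℚ.+-identityʳ p)
      onlyEmpty : ∀ r f X →
        𝔼 (choose (kSubsets r 0) {{kSubsets-nonEmpty {r} ℕ.z≤n}} >>= λ S → return (plant G S X))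
          f ≡ f X
      onlyEmpty zero    f X = trans (single (f (plant G ∅ X))) (cong f (plant-∅ X))
      onlyEmpty (suc r) f X = trans (single (f (plant G ∅ X))) (cong f (plant-∅ X))

  module Success {c ℓ} (k : ℕ) (E : GroupEnsemble c ℓ) (P : Program) (T : ℕ → ℕ) (r : ℕ)
    .{{_ : NonZero r}} where

    open GroupEnsemble E
    open Planting (group r)
    open FiniteAbelianGroup (group r) using (abelianGroup; _≈_; _≈?_; 0#)

    -- The function s of the overview. The coins are averaged out, so it takes values in [0, 1]
    -- rather than being an indicator.
    success : Vec (Carrier r) r → ℚ
    success X = 𝔼 (run P (T r) (encodeInput r (toList X))) (λ w → 𝟙 (isSolution (group r) k X w))

    0≤success : ∀ X → 0ℚ ≤ success X
    0≤success X =
      𝔼-≥0 (run P (T r) (encodeInput r (toList X))) (λ w → 0≤𝟙 (isSolution (group r) k X w))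

    success≤1 : ∀ X → success X ≤ 1ℚ
    success≤1 X =
      𝔼-≤ (run P (T r) (encodeInput r (toList X))) (λ w → 𝟙≤1 (isSolution (group r) k X w))

    successProbability≡ : ∀ D → successProbability k E P T r D ≡ 𝔼 D success
    successProbability≡ D = begin
      Pr (D >>= attempt) (λ b → b)     ≡⟨ Pr≡𝔼 (D >>= attempt) (λ b → b) ⟩
      𝔼 (D >>= attempt) 𝟙              ≡⟨ 𝔼->>= D attempt 𝟙 ⟩
      𝔼 D (λ X → 𝔼 (attempt X) 𝟙)
        ≡⟨ 𝔼-cong D (λ X → 𝔼->>= (run P (T r) (encodeInput r (toList X)))
                                            (λ w → return (isSolution (group r) k X w)) 𝟙) ⟩
      𝔼 D success                      ∎
      where
      open ≡-Reasoning
      attempt : Vec (Carrier r) r → Rand Bool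
      attempt X =
        run P (T r) (encodeInput r (toList X)) >>= λ w → return (isSolution (group r) k X w)

    encodeInput-cong : ∀ {n} {X Y : Vec (Carrier r) n} → Pointwise _≈_ X Y →
                       encodeInput r (toList X) ≡ encodeInput r (toList Y)
    encodeInput-cong X≈Y = cong (r ∷_) (go X≈Y)
      where
      block : Carrier r → List ℕ
      block x = length (encode r x) ∷ encode r x
      go : ∀ {n} {X Y : Vec (Carrier r) n} → Pointwise _≈_ X Y →
        concatMap block (toList X) ≡ concatMap block (toList Y)
      go []          = refl
      go (x≈y ∷ X≈Y) =
        cong₂ _++_ (cong (λ e → length e ∷ e) (Injection.cong (encoding r) x≈y)) (go X≈Y)

    isSolution-cong : ∀ {n} {X Y : Vec (Carrier r) n} → Pointwise _≈_ X Y → ∀ w →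
                      isSolution (group r) k X w ≡ isSolution (group r) k Y w
    isSolution-cong {n} X≈Y w with decode (group r) n w
    ... | just S  =
      cong (does (∣ S ∣ ℕ.≟ k) ∧_)
        (≈?-cong (subsetSum-cong S X≈Y) (AbelianGroup.refl abelianGroup))
    ... | nothing = refl

    -- Encodings identify equivalent elements, so the algorithm reads the same input, and the test
    -- of a solution compares group elements only up to `_≈_`.
    success-cong : Respects success
    success-cong {X} {Y} X≈Y = trans
      (cong (λ i → 𝔼 (run P (T r) i) (λ w → 𝟙 (isSolution (group r) k X w)))
        (encodeInput-cong X≈Y))
      (𝔼-cong (run P (T r) (encodeInput r (toList Y))) (λ w → cong 𝟙 (isSolution-cong X≈Y w)))

  -- From cubes of rationals to the power 3/2 of a real

  cube : ℚ → ℚ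
  cube x = x * (x * x)

  -- The easy regime x³ ≤ x² ≤ p². It serves k = 0, and planted success probabilities below the
  -- approximation error.
  cube-≤ : ∀ {κ x p} → 1ℚ ≤ κ → 0ℚ ≤ x → x ≤ 1ℚ → x ≤ p → cube x ≤ ι 37 * (κ * κ) * (p * p)
  cube-≤ {κ} {x} {p} 1≤κ 0≤x x≤1 x≤p = *-mono-≤ 0≤x (0≤* 0≤p 0≤p)
    (ℚ.≤-trans x≤1 (*-mono-≤ {1ℚ} {ι 37} {1ℚ} 0≤1 (0≤square κ)
      (subst (_≤ ι 37) ι1≡1 (ι-mono {1} {37} (ℕ.s≤s ℕ.z≤n)))
      (*-mono-≤ {1ℚ} {κ} {1ℚ} {κ} 0≤1 (ℚ.≤-trans 0≤1 1≤κ) 1≤κ 1≤κ)))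
    (*-mono-≤ 0≤x 0≤p x≤p x≤p)
    where 0≤p = ℚ.≤-trans 0≤x x≤p

  cube-planted-≤ : ∀ {c ℓ} (k : ℕ) (E : GroupEnsemble c ℓ) (P : Program) (T : ℕ → ℕ) (r : ℕ)
    .{{_ : NonZero r}} (k≤r : k ℕ.≤ r) →
    GroupEnsemble.order E r ℕ.≤ 4 ℕ.* r ℕ.^ k →
    let open Success k E P T r in ∀ {p} → 0ℚ < p →
    𝔼 (D₀ (GroupEnsemble.group E r) r) success ≤ p →
    cube (𝔼 (D₁ (GroupEnsemble.group E r) k r k≤r) success) ≤
    ι 37 * (ι (k ℕ.^ k) * ι (k ℕ.^ k)) * (p * p)
  cube-planted-≤ zero E P T r 0≤r _ {p} _ 𝔼≤p =
    subst (λ q → cube q ≤ ι 37 * (ι 1 * ι 1) * (p * p)) (sym (𝔼-D₁-0 G r 0≤r success))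
      (cube-≤ {ι 1} (ℚ.≤-reflexive (sym ι1≡1)) (𝔼-≥0 (D₀ G r) 0≤success)
        (𝔼-≤ (D₀ G r) success≤1) 𝔼≤p)
    where
    G = GroupEnsemble.group E r
    open Success 0 E P T r
  cube-planted-≤ k@(suc _) E P T r k≤r ∣G∣≤4r^k =
    planted³-≤ (GroupEnsemble.group E r) k≤r (ℕ.s≤s ℕ.z≤n) ∣G∣≤4r^k success success-cong 0≤success
      success≤1
    where open Success k E P T r

  -- The origin of 21: doubling costs 8 in the cube, and 8 · 37 = 296 ≤ 441 = 21².
  eightfold-≤ : ∀ {κ p q ε} → 0ℚ ≤ q → ε ≤ q + q → cube q ≤ ι 37 * (κ * κ) * (p * p) →
                0ℚ ℚ.⊔ (ε * ε * ε) ≤ (ι 21 * κ * p) * (ι 21 * κ * p)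
  eightfold-≤ {κ} {p} {q} {ε} 0≤q ε≤2q q³≤ = ℚ.⊔-lub (0≤square (ι 21 * κ * p)) (begin
    ε * ε * ε                                        ≤⟨ ε³≤ ⟩
    (q + q) * (q + q) * (q + q)
      ≡⟨ solve 1 (λ q → (q :+ q) :* (q :+ q) :* (q :+ q) := con ((+ 8) / 1) :* (q :* (q :* q)))
        refl q ⟩
    ((+ 8) / 1) * cube q                               ≡⟨ cong (_* cube q) (ι≡/1 8) ⟨
    ι 8 * cube q                                       ≤⟨ *-monoˡ (ι 8) (0≤ι 8) q³≤ ⟩
    ι 8 * (ι 37 * (κ * κ) * (p * p))
      ≡⟨ solve 4 (λ a b k p → a :* (b :* (k :* k) :* (p :* p)) :=
          (a :* b) :* ((k :* p) :* (k :* p)))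
        refl (ι 8) (ι 37) κ p ⟩
    (ι 8 * ι 37) * ((κ * p) * (κ * p))
      ≤⟨ *-monoʳ ((κ * p) * (κ * p)) (0≤square (κ * p)) 8*37≤21² ⟩
    (ι 21 * ι 21) * ((κ * p) * (κ * p))
      ≡⟨ solve 3 (λ a k p → (a :* a) :* ((k :* p) :* (k :* p)) := (a :* k :* p) :* (a :* k :* p))
        refl (ι 21) κ p ⟩
    (ι 21 * κ * p) * (ι 21 * κ * p)            ∎)
    where
    open ℚ.≤-Reasoning
    open +-*-Solver
    8*37≤21² : ι 8 * ι 37 ≤ ι 21 * ι 21
    8*37≤21² = subst₂ _≤_ (ι-* 8 37) (ι-* 21 21) (ι-mono (ℕ.≤ᵇ⇒≤ (8 ℕ.* 37) (21 ℕ.* 21) _))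
    0≤2q = 0≤+ 0≤q 0≤q
    ε³≤ : ε * ε * ε ≤ (q + q) * (q + q) * (q + q)
    -- An approximant may be negative even if the real is not; its cube is then at most 0.
    ε³≤ with ℚ.≤-total 0ℚ ε
    ... | inj₁ 0≤ε = *-mono-≤ (0≤* 0≤ε 0≤ε) 0≤2q (*-mono-≤ 0≤ε 0≤2q ε≤2q ε≤2q) ε≤2q
    ... | inj₂ ε≤0 = ℚ.≤-trans (*-monoˡ (ε * ε) (0≤square ε) ε≤0)
      (ℚ.≤-trans (ℚ.≤-reflexive (ℚ.*-zeroʳ (ε * ε))) (0≤* (0≤* 0≤2q 0≤2q) 0≤2q))

  -- Eventually an approximant of `x` is at most δ + p₁, hence at most twice the larger of the two.
  -- If that is `p₁`, the assumed cube bound applies; if it is δ, `cube-≤` does.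
  ^3/2-≤ : ∀ (x : ℝ) (k : ℕ) {p₀ p₁ : ℚ} → 0ℚ ≤ p₀ → 0ℚ ≤ p₁ →
           (∀ {p} → 0ℚ < p → p₀ ≤ p → cube p₁ ≤ ι 37 * (ι (k ℕ.^ k) * ι (k ℕ.^ k)) * (p * p)) →
           x ≤ℝ fromℚ p₁ → _/ℕ_ (x ^3/2) (21 ℕ.* k ℕ.^ k) {{21k^k≢0 k}} ≤ℝ fromℚ p₀
  ^3/2-≤ x k {p₀} {p₁} 0≤p₀ 0≤p₁ p₁³≤ x≤p₁ e 0<e = let (N , x≤) = x≤p₁ δ 0<δ in
    N , λ n N≤n → bound n (x≤ n N≤n)
    where
    open ℚ.≤-Reasoning
    open +-*-Solver
    κ = ι (k ℕ.^ k)
    1≤κ : 1ℚ ≤ κ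
    1≤κ = 1≤ιk^k k
    -- At most 1 and at most e ≤ p, the two bounds that `cube-≤` asks of δ.
    δ = 1ℚ ℚ.⊓ e
    0<δ : 0ℚ < δ
    0<δ with ℚ.⊓-sel 1ℚ e
    ... | inj₁ δ≡1 = subst (0ℚ <_) (sym δ≡1) (ℚ.positive⁻¹ 1ℚ)
    ... | inj₂ δ≡e = subst (0ℚ <_) (sym δ≡e) 0<e
    -- The error allowed in the conclusion makes `p` positive even when `p₀` is 0.
    p = e + p₀
    e≤p : e ≤ p
    e≤p = subst (_≤ p) (ℚ.+-identityʳ e) (ℚ.+-monoʳ-≤ e 0≤p₀)
    p₀≤p : p₀ ≤ p
    p₀≤p = subst (_≤ p) (ℚ.+-identityˡ p₀) (ℚ.+-monoˡ-≤ p₀ (ℚ.<⇒≤ 0<e))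
    0<p = ℚ.<-≤-trans 0<e e≤p
    0≤p = ℚ.<⇒≤ 0<p

    cubed : ∀ {ε} → ε ≤ δ + p₁ → 0ℚ ℚ.⊔ (ε * ε * ε) ≤ (ι 21 * κ * p) * (ι 21 * κ * p)
    cubed {ε} ε≤ with ℚ.≤-total δ p₁
    ... | inj₁ δ≤p₁ = eightfold-≤ 0≤p₁ (ℚ.≤-trans ε≤ (ℚ.+-monoˡ-≤ p₁ δ≤p₁)) (p₁³≤ 0<p p₀≤p)
    ... | inj₂ p₁≤δ = eightfold-≤ (ℚ.<⇒≤ 0<δ) (ℚ.≤-trans ε≤ (ℚ.+-monoʳ-≤ δ p₁≤δ))
      (cube-≤ 1≤κ (ℚ.<⇒≤ 0<δ) (ℚ.p⊓q≤p 1ℚ e) (ℚ.≤-trans (ℚ.p⊓q≤q 1ℚ e) e≤p))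

    bound : ∀ n → ℝ.seq x n ≤ δ + p₁ →
      sqrtℚ (0ℚ ℚ.⊔ ℝ.seq (x *ℝ x *ℝ x) n) n * (_/_ (+ 1) (21 ℕ.* k ℕ.^ k) {{21k^k≢0 k}}) ≤ p
    bound n ε≤ = begin
      root * v                     ≤⟨ *-monoʳ v (0≤1/ (21 ℕ.* k ℕ.^ k) {{21k^k≢0 k}}) root≤ ⟩
      ι 21 * κ * p * v         ≡⟨ cong (λ z → z * p * v) (ι-* 21 (k ℕ.^ k)) ⟨
      ι (21 ℕ.* k ℕ.^ k) * p * v
        ≡⟨ solve 3 (λ a p v → a :* p :* v := p :* (a :* v)) refl (ι (21 ℕ.* k ℕ.^ k)) p v ⟩
      p * (ι (21 ℕ.* k ℕ.^ k) * v)   ≡⟨ cong (p *_) (ι*1/ (21 ℕ.* k ℕ.^ k) {{21k^k≢0 k}}) ⟩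
      p * 1ℚ                       ≡⟨ ℚ.*-identityʳ p ⟩
      p                              ∎
      where
      v = _/_ (+ 1) (21 ℕ.* k ℕ.^ k) {{21k^k≢0 k}}
      u = 0ℚ ℚ.⊔ ℝ.seq (x *ℝ x *ℝ x) n
      root = sqrtℚ u n
      root≤ : root ≤ ι 21 * κ * p
      root≤ = square-cancel-≤ (fraction-nonNeg (sqrtNumerator u n) n)
        (0≤* (0≤* (0≤ι 21) (ℚ.≤-trans 0≤1 1≤κ)) 0≤p)
        (ℚ.≤-trans (SqrtBounds.sqrt-lower u (ℚ.p≤p⊔q 0ℚ (ℝ.seq (x *ℝ x *ℝ x) n)) n) (cubed ε≤))

open import Data.Nat.Base using (_*_; _^_)

theorem4p1 : ∀ {c ℓ} (k : ℕ) (E : GroupEnsemble c ℓ) (adm : Admissible k E) →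
    Admissible.Δ adm ≃ℝ 1ℝ →
    (P : Program) (T : ℕ → ℕ) → RunsInTime E P T →
    (ε : ℕ → ℝ) → (∀ r .{{_ : NonZero r}} → 0ℝ ≤ℝ ε r) →
    SolvesPlanted k E P T ε →
    SolvesNonPlanted k E P T (λ r → _/ℕ_ (ε r ^3/2) (21 * k ^ k) {{21k^k≢0 k}})
theorem4p1 k E adm Δ≃1 P T _ ε _ planted r k≤r =
  subst (λ p → _/ℕ_ (ε r ^3/2) (21 * k ^ k) {{21k^k≢0 k}} ≤ℝ fromℚ p)
    (sym (successProbability≡ (D₀ G r)))
    (^3/2-≤ (ε r) k (𝔼-≥0 (D₀ G r) 0≤success) (𝔼-≥0 (D₁ G k r k≤r) 0≤success)
      (cube-planted-≤ k E P T r k≤r (order-≤ k E adm Δ≃1 r))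
      (subst (λ p → ε r ≤ℝ fromℚ p) (successProbability≡ (D₁ G k r k≤r)) (planted r k≤r)))
  where
  G = GroupEnsemble.group E r
  open Success k E P T r
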